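{- Let $M\ge1$ be an integer. For every $m\ge0$, $$f_m^{[M]}(t)=(-1)^m q_m(1,t,\ldots,t^{M-1}).$$ In particular, $(-1)^m f_m^{[M]}(t)\in\mathbb{N}[t]$. Moreover, $$(-1)^m f_m^{[M]}(t)=\sum_{a=0}^{\min(M,m)}t^{\binom a2}\begin{bmatrix} M \\ a \end{bmatrix}_t\begin{bmatrix} M+m-a-1 \\ m-a \end{bmatrix}_t.$$
   Context: Let $t$ be an indeterminate. The coefficients $f_m^{[M]}(t)$ are defined by $F_{t,t^M}(u)=\sum_{m\ge0}f_m^{[M]}(t)u^m$, where $$F_{t,s}(u)=\exp\Big(-2\sum_{n\ge1,\ n\text{ odd}}\frac{1-s^n}{1-t^n}\frac{u^n}{n}\Big)$$ as a formal power series in $u$. The one-row Schur $Q$-function $q_m$ in variables $x_1,\ldots,x_M$ is defined by $\sum_{m\ge0}q_m(x_1,\ldots,x_M)z^m=\prod_{i=1}^M\frac{1+x_iz}{1-x_iz}$. $\begin{bmatrix} n \\ k \end{bmatrix}_t$ is the Gaussian binomial coefficient in $t$, and $\mathbb{N}[t]$ denotes polynomials with nonnegative integer coefficients. -}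

module Defs where

open import Algebra.Bundles using (RawRing)
import Algebra.Definitions.RawSemiring as RawSemiringDefinitions
open import Data.Fin.Base using (toℕ)
open import Data.Integer.Base as ℤ using (ℤ; +_)
open import Data.List.Base using (List; []; _∷_; map)
open import Data.Nat.Base as ℕ using (ℕ; zero; suc; _∸_; _!; NonZero; parity)
open import Data.Nat.Properties using (_!≢0)
open import Data.Parity.Base using (0ℙ; 1ℙ)
open import Data.Product.Base using (∃; _,_)
open import Data.Rational.Base as ℚ using (ℚ; 0ℚ; 1ℚ)
import Data.Rational.Properties as ℚ
open import Data.Vec.Functional using (Vector)
open import Function.Base using (_∘_)
open import Level using (0ℓ)
open import Relation.Binary.PropositionalEquality
open import Relation.Nullary.Decidable using (yes; no)
open import Relation.Nullary.Negation using (contradiction)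

-- Formal power series over R in one variable, as coefficient sequences.

module PowerSeries {c ℓ} (R : RawRing c ℓ) where

  open RawRing R renaming (rawSemiring to R-rawSemiring)
  open RawSemiringDefinitions R-rawSemiring using (sum; _^_)

  Series : Set c
  Series = ℕ → Carrier

  Σ≤ : ℕ → (ℕ → Carrier) → Carrier
  Σ≤ n f = sum {n = suc n} (f ∘ toℕ)

  1ₛ : Series
  1ₛ zero    = 1#
  1ₛ (suc _) = 0#

  infixl 7 _*ₛ_

  _*ₛ_ : Series → Series → Series
  (f *ₛ g) n = Σ≤ n λ k → f k * g (n ∸ k)

  rawRing : RawRing c ℓ
  rawRing = record
    { Carrier = Series
    ; _≈_     = λ f g → ∀ n → f n ≈ g n
    ; _+_     = λ f g n → f n + g n
    ; _*_     = _*ₛ_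
    ; -_      = λ f n → - f n
    ; 0#      = λ _ → 0#
    ; 1#      = 1ₛ
    }

  open RawSemiringDefinitions (RawRing.rawSemiring rawRing) public
    using () renaming (_^_ to _^ₛ_; product to productₛ)

  1+_z : Carrier → Series
  (1+ x z) zero          = 1#
  (1+ x z) (suc zero)    = x
  (1+ x z) (suc (suc _)) = 0#

  -- The expansion 1/(1 - xz) = Σ xᵏ zᵏ of the inverse of 1 - xz.
  1/1-_z : Carrier → Series
  (1/1- x z) k = x ^ k

  -- One-row Schur Q-functions evaluated at x₁, …, x_M: q x m is the
  -- coefficient of zᵐ in ∏ᵢ (1 + xᵢ z)/(1 - xᵢ z).
  q : ∀ {M} → Vector Carrier M → Series
  q x = productₛ λ i → (1+ x i z) *ₛ (1/1- x i z)

  -- exp f = Σ fᵏ/k! for a series f with zero constant term, so that only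
  -- the powers fᵏ with k ≤ n contribute to the coefficient at n.
  -- ι is the structure map making R a ℚ-algebra.
  module Exponential (ι : ℚ → Carrier) where

    exp : Series → Series
    exp f n = Σ≤ n λ k → ι ((+ 1 ℚ./ k !) {{k !≢0}}) * (f ^ₛ k) n

-- ℚ[t]: lists of coefficients, constant term first, compared up to trailing
-- zeros.

module ℚ[t] where

  Poly : Set
  Poly = List ℚ

  coeff : Poly → ℕ → ℚ
  coeff []      _       = 0ℚ
  coeff (a ∷ p) zero    = a
  coeff (a ∷ p) (suc i) = coeff p i

  infix  4 _≈_
  infixl 6 _+_
  infixl 7 _*_ _·_
  infix  8 -_

  _≈_ : Poly → Poly → Set
  p ≈ r = ∀ i → coeff p i ≡ coeff r i

  NonZeroPoly : Poly → Set
  NonZeroPoly p = ∃ λ i → coeff p i ≢ 0ℚ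

  _+_ : Poly → Poly → Poly
  []      + r       = r
  (a ∷ p) + []      = a ∷ p
  (a ∷ p) + (b ∷ r) = (a ℚ.+ b) ∷ (p + r)

  -_ : Poly → Poly
  -_ = map (λ a → ℚ.- a)

  _·_ : ℚ → Poly → Poly
  a · p = map (a ℚ.*_) p

  _*_ : Poly → Poly → Poly
  []      * r = []
  (a ∷ p) * r = a · r + (0ℚ ∷ p * r)

  const : ℚ → Poly
  const a = a ∷ []

  t : Poly
  t = 0ℚ ∷ 1ℚ ∷ []

  rawRing : RawRing 0ℓ 0ℓ
  rawRing = record
    { Carrier = Poly
    ; _≈_     = _≈_
    ; _+_     = _+_
    ; _*_     = _*_
    ; -_      = -_
    ; 0#      = []
    ; 1#      = const 1ℚ
    }

  open RawSemiringDefinitions (RawRing.rawSemiring rawRing) public using (_^_)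

  coeff-+ : ∀ p r i → coeff (p + r) i ≡ coeff p i ℚ.+ coeff r i
  coeff-+ []      r       i       = sym (ℚ.+-identityˡ _)
  coeff-+ (a ∷ p) []      i       = sym (ℚ.+-identityʳ _)
  coeff-+ (a ∷ p) (b ∷ r) zero    = refl
  coeff-+ (a ∷ p) (b ∷ r) (suc i) = coeff-+ p r i

  coeff-· : ∀ a p i → coeff (a · p) i ≡ a ℚ.* coeff p i
  coeff-· a []      i       = sym (ℚ.*-zeroʳ a)
  coeff-· a (b ∷ p) zero    = refl
  coeff-· a (b ∷ p) (suc i) = coeff-· a p i

  coeff-∷* : ∀ a p r i →
    coeff ((a ∷ p) * r) i ≡ a ℚ.* coeff r i ℚ.+ coeff (0ℚ ∷ p * r) i
  coeff-∷* a p r i =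
    trans (coeff-+ (a · r) _ i) (cong (ℚ._+ _) (coeff-· a r i))

  coeff-*0∷ : ∀ p r i → coeff (p * (0ℚ ∷ r)) i ≡ coeff (0ℚ ∷ p * r) i
  coeff-*0∷ []      r zero    = refl
  coeff-*0∷ []      r (suc i) = refl
  coeff-*0∷ (a ∷ p) r zero    =
    trans (ℚ.+-identityʳ _) (ℚ.*-zeroʳ a)
  coeff-*0∷ (a ∷ p) r (suc i) = trans (coeff-∷* a p (0ℚ ∷ r) (suc i))
    (trans (cong (a ℚ.* coeff r i ℚ.+_) (coeff-*0∷ p r i))
           (sym (coeff-∷* a p r i)))

  ℚ-*-nonZero : ∀ {a b} → a ≢ 0ℚ → b ≢ 0ℚ → a ℚ.* b ≢ 0ℚ
  ℚ-*-nonZero {a} {b} a≢0 b≢0 ab≡0 = b≢0 (begin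
    b                     ≡⟨ ℚ.*-identityˡ b ⟨
    1ℚ ℚ.* b              ≡⟨ cong (ℚ._* b) (ℚ.*-inverseˡ a) ⟨
    ℚ.1/ a ℚ.* a ℚ.* b    ≡⟨ ℚ.*-assoc (ℚ.1/ a) a b ⟩
    ℚ.1/ a ℚ.* (a ℚ.* b)  ≡⟨ cong (ℚ.1/ a ℚ.*_) ab≡0 ⟩
    ℚ.1/ a ℚ.* 0ℚ         ≡⟨ ℚ.*-zeroʳ (ℚ.1/ a) ⟩
    0ℚ                    ∎)
    where
    open ≡-Reasoning
    instance _ = ℚ.≢-nonZero a≢0

  *-nonZero : ∀ p r → NonZeroPoly p → NonZeroPoly r → NonZeroPoly (p * r)
  *-nonZero [] r (_ , 0≢0) _ = contradiction refl 0≢0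
  *-nonZero (a ∷ p) [] _ (_ , 0≢0) = contradiction refl 0≢0
  *-nonZero (a ∷ p) (b ∷ r) p≢0 r≢0 with a ℚ.≟ 0ℚ | b ℚ.≟ 0ℚ
  ... | no a≢0 | no b≢0 =
    0 , ℚ-*-nonZero a≢0 b≢0 ∘ trans (sym (ℚ.+-identityʳ (a ℚ.* b)))
  *-nonZero (a ∷ p) (b ∷ r) p≢0 (zero  , b≢0) | _ | yes b≡0 =
    contradiction b≡0 b≢0
  *-nonZero (a ∷ p) (b ∷ r) p≢0 (suc i , r≢0) | _ | yes refl =
    let j , c≢0 = *-nonZero (a ∷ p) r p≢0 (i , r≢0)
    in  suc j , c≢0 ∘ trans (sym (coeff-*0∷ (a ∷ p) r (suc j)))
  *-nonZero (a ∷ p) (b ∷ r) (zero  , a≢0) r≢0 | yes a≡0 | no _ =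
    contradiction a≡0 a≢0
  *-nonZero (a ∷ p) (b ∷ r) (suc i , p≢0) r≢0 | yes refl | no _ =
    let j , c≢0 = *-nonZero p (b ∷ r) (i , p≢0) r≢0
        c = coeff (p * (b ∷ r)) j
    in  suc j , c≢0 ∘ trans (sym (trans (coeff-∷* 0ℚ p (b ∷ r) (suc j))
          (trans (cong (ℚ._+ c) (ℚ.*-zeroˡ (coeff r j))) (ℚ.+-identityˡ c))))

  1-nonZero : NonZeroPoly (const 1ℚ)
  1-nonZero = 0 , λ ()

  coeff-t*-zero : ∀ p → coeff (t * p) 0 ≡ 0ℚ
  coeff-t*-zero p = trans (coeff-∷* 0ℚ (1ℚ ∷ []) p 0)
    (trans (ℚ.+-identityʳ _) (ℚ.*-zeroˡ (coeff p 0)))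

  coeff-neg : ∀ p i → coeff (- p) i ≡ ℚ.- coeff p i
  coeff-neg []      i       = refl
  coeff-neg (a ∷ p) zero    = refl
  coeff-neg (a ∷ p) (suc i) = coeff-neg p i

  1-t^n-nonZero : ∀ n .{{_ : NonZero n}} → NonZeroPoly (const 1ℚ + - (t ^ n))
  1-t^n-nonZero (suc n) = 0 , λ c≡0 → contradiction (trans (sym c≡1) c≡0) λ ()
    where
    c≡1 : coeff (const 1ℚ + - (t ^ suc n)) 0 ≡ 1ℚ
    c≡1 = trans (coeff-+ (const 1ℚ) (- (t ^ suc n)) 0)
      (cong (1ℚ ℚ.+_) (trans (coeff-neg (t ^ suc n) 0)
                             (cong (λ a → ℚ.- a) (coeff-t*-zero (t ^ n)))))

-- The field ℚ(t): fractions of polynomials, compared by cross-multiplication.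

record ℚ⟨t⟩ : Set where
  constructor fraction
  field
    num     : ℚ[t].Poly
    den     : ℚ[t].Poly
    den≢0   : ℚ[t].NonZeroPoly den

infix  4 _≈_
infixl 6 _+_ _-_
infixl 7 _*_
infix  8 -_

_≈_ : ℚ⟨t⟩ → ℚ⟨t⟩ → Set
fraction a b _ ≈ fraction c d _ = a ℚ[t].* d ℚ[t].≈ c ℚ[t].* b

_+_ : ℚ⟨t⟩ → ℚ⟨t⟩ → ℚ⟨t⟩
fraction a b b≢0 + fraction c d d≢0 =
  fraction (a ℚ[t].* d ℚ[t].+ c ℚ[t].* b) (b ℚ[t].* d)
           (ℚ[t].*-nonZero b d b≢0 d≢0)

_*_ : ℚ⟨t⟩ → ℚ⟨t⟩ → ℚ⟨t⟩
fraction a b b≢0 * fraction c d d≢0 =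
  fraction (a ℚ[t].* c) (b ℚ[t].* d) (ℚ[t].*-nonZero b d b≢0 d≢0)

-_ : ℚ⟨t⟩ → ℚ⟨t⟩
- fraction a b b≢0 = fraction (ℚ[t].- a) b b≢0

_-_ : ℚ⟨t⟩ → ℚ⟨t⟩ → ℚ⟨t⟩
x - y = x + - y

fromPoly : ℚ[t].Poly → ℚ⟨t⟩
fromPoly p = fraction p (ℚ[t].const 1ℚ) ℚ[t].1-nonZero

fromℚ : ℚ → ℚ⟨t⟩
fromℚ = fromPoly ∘ ℚ[t].const

0# 1# t : ℚ⟨t⟩
0# = fromPoly []
1# = fromℚ 1ℚ
t  = fromPoly ℚ[t].t

rawRing : RawRing 0ℓ 0ℓ
rawRing = record
  { Carrier = ℚ⟨t⟩
  ; _≈_     = _≈_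
  ; _+_     = _+_
  ; _*_     = _*_
  ; -_      = -_
  ; 0#      = 0#
  ; 1#      = 1#
  }

open RawSemiringDefinitions (RawRing.rawSemiring rawRing) public
  using (_^_; product)

open PowerSeries rawRing public using (Series; Σ≤; q)
open PowerSeries.Exponential rawRing fromℚ public using (exp)

1/[1-t^_] : ∀ n .{{_ : NonZero n}} → ℚ⟨t⟩
1/[1-t^ n ] = fraction (ℚ[t].const 1ℚ)
  (ℚ[t].const 1ℚ ℚ[t].+ ℚ[t].- (ℚ[t].t ℚ[t].^ n)) (ℚ[t].1-t^n-nonZero n)

-- The series  -2 Σ_{n odd} (1 - sⁿ)/(1 - tⁿ) uⁿ/n  in u.
logF : ℚ⟨t⟩ → Series
logF s zero      = 0#
logF s n@(suc _) with parity n
... | 0ℙ = 0#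
... | 1ℙ = fromℚ ((ℤ.- + 2) ℚ./ n) * ((1# - s ^ n) * 1/[1-t^ n ])

F : ℚ⟨t⟩ → Series
F s = exp (logF s)

f : ℕ → Series
f M = F (t ^ M)

-- The Gaussian binomial ∏_{i<k} (1 - tⁿ⁻ⁱ)/(1 - tⁱ⁺¹). For k > n the factor
-- i = n is 1 - t⁰, so the value is 0.
gaussian : ℕ → ℕ → ℚ⟨t⟩
gaussian n k =
  product {n = k} λ i → (1# - t ^ (n ∸ toℕ i)) * 1/[1-t^ suc (toℕ i) ]

-- ℕ[t] as lists of coefficients, constant term first.
ℕ[t] : Set
ℕ[t] = List ℕ

fromℕ[t] : ℕ[t] → ℚ⟨t⟩
fromℕ[t] = fromPoly ∘ map (λ n → + n ℚ./ 1)

{-# OPTIONS --safe #-}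
module Submission where

-- Write θ = z d/dz, and call θf / f the logarithmic derivative of a series f.
-- Substituting -z for z turns the coefficients q_m(x) into (-1)^m q_m(x) and
-- the series Σ q_m zᵐ into Q = ∏ᵢ (1 + yᵢ z)/(1 - yᵢ z) with yᵢ = -xᵢ
-- (q-scale). The logarithmic derivative of Q is a sum over the factors
-- (LogDeriv-q), and its coefficient at zⁿ is ((-1)ⁿ - 1) Σᵢ xᵢⁿ for n ≥ 1. For
-- xᵢ = tⁱ, i < M, the power sum is (1 - tᴹⁿ)/(1 - tⁿ) (power-sum), so this is
-- the coefficient of θL at zⁿ, where L is the exponent in the definition of F
-- (logF-coeff). Now θL is the logarithmic derivative of exp L
-- (LogDeriv-exp), and over a ring containing ℚ a series is determined by its
-- constant term and its logarithmic derivative (LogDeriv-unique). Hence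
-- exp L = Q (exp-q), which is the first claim.
--
-- Multiplying by (-1)^m again leaves q_m(1, t, …, tᴹ⁻¹). This lies in ℕ[t]
-- because q_m is built from the xᵢ by additions and multiplications only
-- (P-q). The last formula is the coefficient of zᵐ in the product of the two
-- q-binomial series, where [n, k] denotes the Gaussian binomial:
--   ∏ᵢ (1 + tⁱ z)   = Σₐ t^(a C 2) [M, a] zᵃ            (E-coeff),
--   ∏ᵢ 1/(1 - tⁱ z) = Σ_b [M + b - 1, b] z^b            (H-coeff).
-- Both follow by induction on M from the same Pascal rule
-- [n+1, k+1] = [n, k] + tᵏ⁺¹ [n, k+1] (pascal), since removing the first
-- factor leaves the product for M - 1 with tz in place of z.
--
-- The argument takes place over a commutative ring with a homomorphism from ℚ
-- in which the 1 - tⁿ⁺¹ are invertible. It remains to see that ℚ(t) is such a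
-- ring. The laws of ℚ[t] come from the embedding into the power series over ℚ
-- by coefficients; those of ℚ(t) follow by cross-multiplication, where the
-- transitivity of equality uses that ℚ[t] has no zero divisors.

open import Algebra.Bundles using (CommutativeRing)
import Algebra.Morphism.RingMonomorphism
open import Algebra.Morphism.Structures using (IsRingHomomorphism; IsRingMonomorphism)
import Algebra.Properties.CommutativeMonoid.Mult
import Algebra.Properties.CommutativeMonoid.Sum
import Algebra.Properties.CommutativeSemiring.Exp
import Algebra.Properties.Group
import Algebra.Properties.Ring
import Algebra.Properties.Semiring.Exp
import Algebra.Properties.Semiring.Mult
import Algebra.Properties.Semiring.Sum
import Algebra.Solver.Ring.NaturalCoefficients.Default
import Defs
open import Defs using (module PowerSeries)
open import Data.Fin.Base using (toℕ; zero; suc)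
open import Data.Integer.Base as ℤ using () renaming (+_ to pos)
import Data.Integer.Properties as ℤ
import Data.Integer.Solver
open import Data.List.Base using ([]; _∷_; map)
open import Data.List.Relation.Unary.All using (All; []; _∷_)
open import Data.Nat.Base as ℕ
  using (ℕ; zero; suc; _∸_; _⊓_; z≤n; s≤s; _!; NonZero; parity)
import Data.Nat.Properties as ℕ
open import Data.Nat.Combinatorics using (_C_; nCk+nC[k+1]≡[n+1]C[k+1]; nC1≡n)
open import Data.Parity.Base using (Parity; 0ℙ; 1ℙ)
open import Data.Product.Base using (_,_)
open import Data.Rational.Base as ℚ using (ℚ; 0ℚ; 1ℚ)
import Data.Rational.Properties as ℚ
import Data.Rational.Unnormalised.Base as ℚᵘ
import Data.Rational.Unnormalised.Properties as ℚᵘ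
open import Data.Sum.Base using (inj₁; inj₂)
open import Data.Vec.Functional using (Vector)
open import Function.Base using (_∘_)
open import Level using (0ℓ)
import Relation.Binary.Reasoning.Setoid
open import Relation.Binary.PropositionalEquality as ≡ using (_≡_)
open import Relation.Nullary.Decidable using (yes; no; decidable-stable)

-- Power series over a commutative ring form a commutative ring

module SeriesRing {c ℓ} (R : CommutativeRing c ℓ) where

  open CommutativeRing R hiding (zero)
  open PowerSeries rawRing hiding (rawRing) public
  open Algebra.Solver.Ring.NaturalCoefficients.Default commutativeSemiring
  open Algebra.Properties.CommutativeMonoid.Sum +-commutativeMonoid
    using (sum-replicate-zero)
  open Relation.Binary.Reasoning.Setoid setoid

  infix 4 _≈ₛ_
  _≈ₛ_ : Series → Series → Set ℓ
  f ≈ₛ g = ∀ n → f n ≈ g n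

  Σ≤-cong : ∀ n {f g : Series} → (∀ k → k ℕ.≤ n → f k ≈ g k) → Σ≤ n f ≈ Σ≤ n g
  Σ≤-cong zero    f≈g = +-congʳ (f≈g 0 z≤n)
  Σ≤-cong (suc n) f≈g =
    +-cong (f≈g 0 z≤n) (Σ≤-cong n λ k k≤n → f≈g (suc k) (s≤s k≤n))

  Σ≤-zero : ∀ n {f} → (∀ k → k ℕ.≤ n → f k ≈ 0#) → Σ≤ n f ≈ 0#
  Σ≤-zero n f≈0 = trans (Σ≤-cong n f≈0) (sum-replicate-zero (suc n))

  Σ≤-truncate : ∀ {n N} f → n ℕ.≤ N → (∀ k → n ℕ.< k → f k ≈ 0#) → Σ≤ N f ≈ Σ≤ n f
  Σ≤-truncate {N = zero}  f z≤n       f≈0 = refl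
  Σ≤-truncate {N = suc N} f z≤n       f≈0 =
    +-congˡ (Σ≤-zero N λ k _ → f≈0 (suc k) (s≤s z≤n))
  Σ≤-truncate             f (s≤s n≤N) f≈0 =
    +-congˡ (Σ≤-truncate (f ∘ suc) n≤N λ k n<k → f≈0 (suc k) (s≤s n<k))

  *ₛ-cong : ∀ {f f′ g g′} → f ≈ₛ f′ → g ≈ₛ g′ → f *ₛ g ≈ₛ f′ *ₛ g′
  *ₛ-cong f≈f′ g≈g′ n = Σ≤-cong n λ k _ → *-cong (f≈f′ k) (g≈g′ (n ∸ k))

  -- By definition (f g)ₙ₊₁ = f₀ gₙ₊₁ + (f∘suc * g)ₙ, which peels the first
  -- coefficient off the left factor; this peels it off the right one.
  *ₛ-sucʳ : ∀ f g n → (f *ₛ g) (suc n) ≈ (f *ₛ (g ∘ suc)) n + f (suc n) * g 0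
  *ₛ-sucʳ f g zero = solve 2 (λ a b → a :+ (b :+ con 0) := (a :+ con 0) :+ b)
    refl (f 0 * g 1) (f 1 * g 0)
  *ₛ-sucʳ f g (suc n) =
    trans (+-congˡ (*ₛ-sucʳ (f ∘ suc) g n)) (sym (+-assoc _ _ _))

  *ₛ-comm : ∀ f g → f *ₛ g ≈ₛ g *ₛ f
  *ₛ-comm f g zero    = +-congʳ (*-comm (f 0) (g 0))
  *ₛ-comm f g (suc n) = begin
    f 0 * g (suc n) + ((f ∘ suc) *ₛ g) n  ≈⟨ +-cong (*-comm _ _) (*ₛ-comm (f ∘ suc) g n) ⟩
    g (suc n) * f 0 + (g *ₛ (f ∘ suc)) n  ≈⟨ +-comm _ _ ⟩
    (g *ₛ (f ∘ suc)) n + g (suc n) * f 0  ≈⟨ *ₛ-sucʳ g f n ⟨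
    (g *ₛ f) (suc n)                      ∎

  *ₛ-distribʳ : ∀ h f g → (λ n → f n + g n) *ₛ h ≈ₛ λ n → (f *ₛ h) n + (g *ₛ h) n
  *ₛ-distribʳ h f g zero = solve 3
    (λ a b c → (a :+ b) :* c :+ con 0 := (a :* c :+ con 0) :+ (b :* c :+ con 0))
    refl (f 0) (g 0) (h 0)
  *ₛ-distribʳ h f g (suc n) = begin
    (f 0 + g 0) * h (suc n) + ((λ k → f (suc k) + g (suc k)) *ₛ h) n
      ≈⟨ +-congˡ (*ₛ-distribʳ h (f ∘ suc) (g ∘ suc) n) ⟩
    (f 0 + g 0) * h (suc n) + (((f ∘ suc) *ₛ h) n + ((g ∘ suc) *ₛ h) n)
      ≈⟨ solve 5 (λ a b c u v → (a :+ b) :* c :+ (u :+ v) := (a :* c :+ u) :+ (b :* c :+ v))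
           refl (f 0) (g 0) (h (suc n)) _ _ ⟩
    (f *ₛ h) (suc n) + (g *ₛ h) (suc n) ∎

  *ₛ-scaleˡ : ∀ a f g → (λ n → a * f n) *ₛ g ≈ₛ λ n → a * (f *ₛ g) n
  *ₛ-scaleˡ a f g zero = solve 3
    (λ a b c → (a :* b) :* c :+ con 0 := a :* (b :* c :+ con 0)) refl a (f 0) (g 0)
  *ₛ-scaleˡ a f g (suc n) = trans (+-congˡ (*ₛ-scaleˡ a (f ∘ suc) g n))
    (solve 4 (λ a b c u → (a :* b) :* c :+ a :* u := a :* (b :* c :+ u))
       refl a (f 0) (g (suc n)) _)

  *ₛ-assoc : ∀ f g h → (f *ₛ g) *ₛ h ≈ₛ f *ₛ (g *ₛ h)
  *ₛ-assoc f g h zero = solve 3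
    (λ a b c → (a :* b :+ con 0) :* c :+ con 0 := a :* (b :* c :+ con 0) :+ con 0)
    refl (f 0) (g 0) (h 0)
  *ₛ-assoc f g h (suc n) = begin
    (f 0 * g 0 + 0#) * h (suc n) + ((λ k → f 0 * g (suc k) + ((f ∘ suc) *ₛ g) k) *ₛ h) n
      ≈⟨ +-congˡ (*ₛ-distribʳ h (λ k → f 0 * g (suc k)) ((f ∘ suc) *ₛ g) n) ⟩
    (f 0 * g 0 + 0#) * h (suc n)
      + (((λ k → f 0 * g (suc k)) *ₛ h) n + (((f ∘ suc) *ₛ g) *ₛ h) n)
      ≈⟨ +-congˡ (+-cong (*ₛ-scaleˡ (f 0) (g ∘ suc) h n) (*ₛ-assoc (f ∘ suc) g h n)) ⟩
    (f 0 * g 0 + 0#) * h (suc n)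
      + (f 0 * ((g ∘ suc) *ₛ h) n + ((f ∘ suc) *ₛ (g *ₛ h)) n)
      ≈⟨ solve 5 (λ a b c u v → (a :* b :+ con 0) :* c :+ (a :* u :+ v)
                              := a :* (b :* c :+ u) :+ v)
           refl (f 0) (g 0) (h (suc n)) _ _ ⟩
    f 0 * (g *ₛ h) (suc n) + ((f ∘ suc) *ₛ (g *ₛ h)) n ∎

  *ₛ-zeroˡ : ∀ g → (λ _ → 0#) *ₛ g ≈ₛ λ _ → 0#
  *ₛ-zeroˡ g zero    = trans (+-identityʳ _) (zeroˡ _)
  *ₛ-zeroˡ g (suc n) = trans (+-cong (zeroˡ _) (*ₛ-zeroˡ g n)) (+-identityʳ _)

  *ₛ-identityˡ : ∀ g → 1ₛ *ₛ g ≈ₛ g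
  *ₛ-identityˡ g zero    = trans (+-identityʳ _) (*-identityˡ _)
  *ₛ-identityˡ g (suc n) =
    trans (+-cong (*-identityˡ _) (*ₛ-zeroˡ g n)) (+-identityʳ _)

  seriesRing : CommutativeRing c ℓ
  seriesRing = record
    { Carrier = Series
    ; _≈_     = _≈ₛ_
    ; _+_     = λ f g n → f n + g n
    ; _*_     = _*ₛ_
    ; -_      = λ f n → - f n
    ; 0#      = λ _ → 0#
    ; 1#      = 1ₛ
    ; isCommutativeRing = record
      { isRing = record
        { +-isAbelianGroup = record
          { isGroup = record
            { isMonoid = record
              { isSemigroup = record
                { isMagma = record
                  { isEquivalence = record
                    { refl  = λ _ → refl
                    ; sym   = λ f≈g n → sym (f≈g n)
                    ; trans = λ f≈g g≈h n → trans (f≈g n) (g≈h n)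
                    }
                  ; ∙-cong = λ f≈g h≈k n → +-cong (f≈g n) (h≈k n)
                  }
                ; assoc = λ f g h n → +-assoc (f n) (g n) (h n)
                }
              ; identity = (λ f n → +-identityˡ (f n)) , (λ f n → +-identityʳ (f n))
              }
            ; inverse = (λ f n → -‿inverseˡ (f n)) , (λ f n → -‿inverseʳ (f n))
            ; ⁻¹-cong = λ f≈g n → -‿cong (f≈g n)
            }
          ; comm = λ f g n → +-comm (f n) (g n)
          }
        ; *-cong     = *ₛ-cong
        ; *-assoc    = *ₛ-assoc
        ; *-identity = *ₛ-identityˡ , λ f n → trans (*ₛ-comm f 1ₛ n) (*ₛ-identityˡ f n)
        ; distrib    =
            (λ f g h n → trans (*ₛ-comm f (λ k → g k + h k) n) (trans (*ₛ-distribʳ f g h n)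
               (+-cong (*ₛ-comm g f n) (*ₛ-comm h f n))))
          , *ₛ-distribʳ
        }
      ; *-comm = *ₛ-comm
      }
    }

-- The Euler operator, logarithmic derivatives and Schur Q-functions

module SeriesCalculus {c ℓ} (R : CommutativeRing c ℓ) where

  open CommutativeRing R hiding (zero)
  open SeriesRing R
  private module S = CommutativeRing seriesRing
  open Algebra.Properties.Ring ring using (-‿distribˡ-*; -‿distribʳ-*)
  open Algebra.Properties.Semiring.Exp semiring using (_^_)
  open Algebra.Properties.CommutativeSemiring.Exp commutativeSemiring
    using (^-distrib-*)
  open Algebra.Properties.Semiring.Mult semiring
    using (_×_; ×-comm-*)
  open Algebra.Properties.CommutativeMonoid.Mult +-commutativeMonoid
    using (×-distrib-+)
  open Algebra.Properties.Semiring.Sum semiring using (sum)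
  open Algebra.Solver.Ring.NaturalCoefficients.Default commutativeSemiring
  open Relation.Binary.Reasoning.Setoid setoid

  -- The Euler operator z d/dz.
  θ : Series → Series
  θ f n = n × f n

  ×0#≈0# : ∀ n → n × 0# ≈ 0#
  ×0#≈0# zero    = refl
  ×0#≈0# (suc n) = trans (+-identityˡ _) (×0#≈0# n)

  θ-1 : θ 1ₛ ≈ₛ λ _ → 0#
  θ-1 zero    = refl
  θ-1 (suc n) = ×0#≈0# (suc n)

  θ-* : ∀ f g → θ (f *ₛ g) ≈ₛ λ n → (θ f *ₛ g) n + (f *ₛ θ g) n
  θ-* f g zero = solve 2 (λ a b → con 0 := (con 0 :* b :+ con 0) :+ (a :* con 0 :+ con 0))
    refl (f 0) (g 0)
  θ-* f g (suc n) = begin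
    suc n × (f 0 * g (suc n) + ((f ∘ suc) *ₛ g) n)
      ≈⟨ ×-distrib-+ _ _ (suc n) ⟩
    suc n × (f 0 * g (suc n)) + (((f ∘ suc) *ₛ g) n + n × ((f ∘ suc) *ₛ g) n)
      ≈⟨ +-cong (sym (×-comm-* (suc n) _ _)) (+-congˡ (θ-* (f ∘ suc) g n)) ⟩
    f 0 * θ g (suc n) + (((f ∘ suc) *ₛ g) n
      + ((θ (f ∘ suc) *ₛ g) n + ((f ∘ suc) *ₛ θ g) n))
      ≈⟨ solve 5 (λ a u v w x → a :+ (u :+ (v :+ w))
                              := (con 0 :* x :+ (u :+ v)) :+ (a :+ w))
           refl (f 0 * θ g (suc n)) (((f ∘ suc) *ₛ g) n) ((θ (f ∘ suc) *ₛ g) n)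
           (((f ∘ suc) *ₛ θ g) n) (g (suc n)) ⟩
    (0# * g (suc n) + (((f ∘ suc) *ₛ g) n + (θ (f ∘ suc) *ₛ g) n))
      + (f *ₛ θ g) (suc n)
      ≈⟨ +-congʳ (+-congˡ (*ₛ-distribʳ g (f ∘ suc) (θ (f ∘ suc)) n)) ⟨
    (θ f *ₛ g) (suc n) + (f *ₛ θ g) (suc n) ∎

  -- w is the logarithmic derivative of f. The equation θf = w f avoids dividing
  -- by f.
  LogDeriv : Series → Series → Set ℓ
  LogDeriv f w = θ f ≈ₛ w *ₛ f

  LogDeriv-1 : LogDeriv 1ₛ (λ _ → 0#)
  LogDeriv-1 n = trans (θ-1 n) (sym (*ₛ-zeroˡ 1ₛ n))

  LogDeriv-* : ∀ {f g v w} → LogDeriv f v → LogDeriv g w →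
               LogDeriv (f *ₛ g) (λ n → v n + w n)
  LogDeriv-* {f} {g} {v} {w} θf θg = S.trans (θ-* f g)
    (S.trans (S.+-cong (*ₛ-cong θf (S.refl {x = g})) (*ₛ-cong (S.refl {x = f}) θg))
      (S′.solve 4 (λ f g v w → v S′.:* f S′.:* g S′.:+ f S′.:* (w S′.:* g)
                          S′.:= (v S′.:+ w) S′.:* (f S′.:* g)) S.refl f g v w))
    where module S′ = Algebra.Solver.Ring.NaturalCoefficients.Default S.commutativeSemiring

  LogDeriv-product : ∀ {M} (f w : Vector Series M) → (∀ i → LogDeriv (f i) (w i)) →
                     LogDeriv (productₛ f) (λ n → sum λ i → w i n)
  LogDeriv-product {zero}  f w θf = LogDeriv-1
  LogDeriv-product {suc M} f w θf =
    LogDeriv-* {f zero} {productₛ (f ∘ suc)} {w zero} {λ n → sum λ i → w (suc i) n}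
    (θf zero) (LogDeriv-product (f ∘ suc) (w ∘ suc) (θf ∘ suc))

  -- The recursion n fₙ = Σₖ wₖ fₙ₋ₖ determines fₙ for n ≥ 1 from the earlier
  -- coefficients: w₀ = 0 removes fₙ from the right-hand side.
  LogDeriv-unique : (∀ n {x y} → suc n × x ≈ suc n × y → x ≈ y) →
    ∀ {f g w} → w 0 ≈ 0# → LogDeriv f w → LogDeriv g w → f 0 ≈ g 0 → f ≈ₛ g
  LogDeriv-unique ×-cancel {f} {g} {w} w₀≈0 θf θg f₀≈g₀ n = below n n ℕ.≤-refl
    where
    below : ∀ n k → k ℕ.≤ n → f k ≈ g k
    below _       zero    _         = f₀≈g₀
    below (suc n) (suc k) (s≤s k≤n) = ×-cancel k (begin
      suc k × f (suc k)                              ≈⟨ θf (suc k) ⟩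
      w 0 * f (suc k) + ((w ∘ suc) *ₛ f) k           ≈⟨ +-congʳ (trans (*-congʳ w₀≈0) (zeroˡ _)) ⟩
      0# + ((w ∘ suc) *ₛ f) k                        ≈⟨ +-cong (sym (trans (*-congʳ w₀≈0) (zeroˡ _)))
                                                       (Σ≤-cong k λ j _ → *-congˡ {w (suc j)} (below n (k ∸ j)
                                                         (ℕ.≤-trans (ℕ.m∸n≤m k j) k≤n))) ⟩
      w 0 * g (suc k) + ((w ∘ suc) *ₛ g) k           ≈⟨ θg (suc k) ⟨
      suc k × g (suc k)                              ∎)

  -- The series xz/(1 - xz), the logarithmic derivative of 1/(1 - xz).
  geom⁺ : Carrier → Series
  geom⁺ x zero    = 0#
  geom⁺ x (suc n) = x ^ suc n

  -- Since xz/(1 - xz) = xz · 1/(1 - xz), this rests on the coefficients n + 1 of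
  -- the square of the geometric series.
  LogDeriv-1/1- : ∀ x → LogDeriv (1/1- x z) (geom⁺ x)
  LogDeriv-1/1- x zero    = sym (trans (+-identityʳ _) (zeroˡ _))
  LogDeriv-1/1- x (suc n) = sym (begin
    0# * x ^ suc n + ((λ k → x * x ^ k) *ₛ (1/1- x z)) n  ≈⟨ +-cong (zeroˡ _) (*ₛ-scaleˡ x (1/1- x z) (1/1- x z) n) ⟩
    0# + x * ((1/1- x z) *ₛ (1/1- x z)) n                 ≈⟨ +-identityˡ _ ⟩
    x * ((1/1- x z) *ₛ (1/1- x z)) n                      ≈⟨ *-congˡ (square n) ⟩
    x * (suc n × x ^ n)                                   ≈⟨ ×-comm-* (suc n) x (x ^ n) ⟩
    suc n × x ^ suc n                                     ∎)
    where
    square : ∀ n → ((1/1- x z) *ₛ (1/1- x z)) n ≈ suc n × x ^ n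
    square zero    = +-congʳ (*-identityˡ 1#)
    square (suc n) = +-cong (*-identityˡ _) (begin
      ((λ k → x * x ^ k) *ₛ (1/1- x z)) n  ≈⟨ *ₛ-scaleˡ x (1/1- x z) (1/1- x z) n ⟩
      x * ((1/1- x z) *ₛ (1/1- x z)) n     ≈⟨ *-congˡ (square n) ⟩
      x * (suc n × x ^ n)                  ≈⟨ ×-comm-* (suc n) x (x ^ n) ⟩
      suc n × x ^ suc n                    ∎)

  1+xz-*-suc : ∀ x f n → ((1+ x z) *ₛ f) (suc n) ≈ f (suc n) + x * f n
  1+xz-*-suc x f n = +-cong (*-identityˡ _) (begin
    (((1+ x z) ∘ suc) *ₛ f) n        ≈⟨ *ₛ-cong tail≈ (S.refl {x = f}) n ⟩
    ((λ k → x * 1ₛ k) *ₛ f) n        ≈⟨ *ₛ-scaleˡ x 1ₛ f n ⟩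
    x * (1ₛ *ₛ f) n                  ≈⟨ *-congˡ (*ₛ-identityˡ f n) ⟩
    x * f n                          ∎)
    where
    tail≈ : (1+ x z) ∘ suc ≈ₛ λ k → x * 1ₛ k
    tail≈ zero    = sym (*-identityʳ x)
    tail≈ (suc _) = sym (zeroʳ x)

  -- The logarithmic derivative of 1 + xz is xz/(1 + xz) = -(yz/(1 - yz)) with
  -- y = -x.
  LogDeriv-1+ : ∀ x → LogDeriv (1+ x z) (λ n → - geom⁺ (- x) n)
  LogDeriv-1+ x n = sym (trans (*ₛ-comm w (1+ x z) n) (lemma n))
    where
    open Algebra.Properties.Ring ring using (-‿involutive; -0#≈0#)
    w : Series
    w n = - geom⁺ (- x) n
    lemma : (1+ x z) *ₛ w ≈ₛ θ (1+ x z)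
    lemma zero = trans (+-identityʳ _) (trans (*-identityˡ _) -0#≈0#)
    lemma (suc zero) = begin
      ((1+ x z) *ₛ w) 1            ≈⟨ 1+xz-*-suc x w 0 ⟩
      - (- x * 1#) + x * - 0#      ≈⟨ +-cong (trans (-‿cong (*-identityʳ _)) (-‿involutive x))
                                             (trans (*-congˡ -0#≈0#) (zeroʳ x)) ⟩
      x + 0#                       ∎
    lemma (suc (suc n)) = begin
      ((1+ x z) *ₛ w) (suc (suc n))                 ≈⟨ 1+xz-*-suc x w (suc n) ⟩
      - (- x * (- x) ^ suc n) + x * - (- x) ^ suc n ≈⟨ +-cong
         (trans (-‿cong (sym (-‿distribˡ-* _ _))) (-‿involutive _)) (sym (-‿distribʳ-* _ _)) ⟩
      x * (- x) ^ suc n - x * (- x) ^ suc n         ≈⟨ -‿inverseʳ _ ⟩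
      0#                                            ≈⟨ ×0#≈0# (suc (suc n)) ⟨
      suc (suc n) × 0#                              ∎

  -- The substitution of az for z, a ring endomorphism of the power series.
  scale : Carrier → Series → Series
  scale a f n = a ^ n * f n

  scale-* : ∀ a f g → scale a (f *ₛ g) ≈ₛ scale a f *ₛ scale a g
  scale-* a f g zero = solve 2
    (λ f g → con 1 :* (f :* g :+ con 0) := (con 1 :* f) :* (con 1 :* g) :+ con 0)
    refl (f 0) (g 0)
  scale-* a f g (suc n) = begin
    a * a ^ n * (f 0 * g (suc n) + ((f ∘ suc) *ₛ g) n)
      ≈⟨ solve 5 (λ a p f g u → a :* p :* (f :* g :+ u)
                            := con 1 :* f :* (a :* p :* g) :+ a :* (p :* u))
           refl a (a ^ n) (f 0) (g (suc n)) _ ⟩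
    1# * f 0 * (a * a ^ n * g (suc n)) + a * scale a ((f ∘ suc) *ₛ g) n
      ≈⟨ +-congˡ (*-congˡ (scale-* a (f ∘ suc) g n)) ⟩
    1# * f 0 * (a * a ^ n * g (suc n)) + a * (scale a (f ∘ suc) *ₛ scale a g) n
      ≈⟨ +-congˡ (*ₛ-scaleˡ a (scale a (f ∘ suc)) (scale a g) n) ⟨
    1# * f 0 * (a * a ^ n * g (suc n)) + ((λ k → a * scale a (f ∘ suc) k) *ₛ scale a g) n
      ≈⟨ +-congˡ (*ₛ-cong (λ k → sym (*-assoc a (a ^ k) (f (suc k)))) (S.refl {x = scale a g}) n) ⟩
    (scale a f *ₛ scale a g) (suc n) ∎

  scale-1 : ∀ a → scale a 1ₛ ≈ₛ 1ₛ
  scale-1 a zero    = *-identityˡ 1#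
  scale-1 a (suc n) = zeroʳ _

  scale-product : ∀ {M} a (f g : Vector Series M) → (∀ i → scale a (f i) ≈ₛ g i) →
                  scale a (productₛ f) ≈ₛ productₛ g
  scale-product {zero}  a f g f≈g = scale-1 a
  scale-product {suc M} a f g f≈g = S.trans (scale-* a (f zero) (productₛ (f ∘ suc)))
    (*ₛ-cong (f≈g zero) (scale-product a (f ∘ suc) (g ∘ suc) (f≈g ∘ suc)))

  scale-involutive : ∀ a f → a * a ≈ 1# → scale a (scale a f) ≈ₛ f
  scale-involutive a f a²≈1 zero    = trans (*-identityˡ _) (*-identityˡ _)
  scale-involutive a f a²≈1 (suc n) = begin
    a * a ^ n * (a * a ^ n * f (suc n))
      ≈⟨ solve 3 (λ a p x → a :* p :* (a :* p :* x) := (a :* a) :* (p :* (p :* x)))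
           refl a (a ^ n) (f (suc n)) ⟩
    (a * a) * (a ^ n * (a ^ n * f (suc n)))
      ≈⟨ *-cong a²≈1 (scale-involutive a (f ∘ suc) a²≈1 n) ⟩
    1# * f (suc n)
      ≈⟨ *-identityˡ _ ⟩
    f (suc n) ∎

  scale-1+ : ∀ a x → scale a (1+ x z) ≈ₛ (1+ (a * x) z)
  scale-1+ a x zero          = *-identityˡ 1#
  scale-1+ a x (suc zero)    = *-congʳ (*-identityʳ a)
  scale-1+ a x (suc (suc n)) = zeroʳ _

  scale-1/1- : ∀ a x → scale a (1/1- x z) ≈ₛ (1/1- (a * x) z)
  scale-1/1- a x n = sym (^-distrib-* a x n)

  -- q_m is homogeneous of degree m.
  q-scale : ∀ {M} a (x : Vector Carrier M) → scale a (q x) ≈ₛ q (λ i → a * x i)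
  q-scale a x = scale-product a _ _ λ i → S.trans (scale-* a (1+ x i z) (1/1- x i z))
    (*ₛ-cong (scale-1+ a (x i)) (scale-1/1- a (x i)))

  LogDeriv-q : ∀ {M} (x : Vector Carrier M) →
               LogDeriv (q x) (λ n → sum λ i → - geom⁺ (- x i) n + geom⁺ (x i) n)
  LogDeriv-q x = LogDeriv-product (λ i → (1+ x i z) *ₛ (1/1- x i z))
    (λ i n → - geom⁺ (- x i) n + geom⁺ (x i) n)
    λ i → LogDeriv-* {1+ x i z} {1/1- x i z} {λ n → - geom⁺ (- x i) n} {geom⁺ (x i)}
            (LogDeriv-1+ (x i)) (LogDeriv-1/1- (x i))

  q₀≈1 : ∀ {M} (x : Vector Carrier M) → q x 0 ≈ 1#
  q₀≈1 {zero}  x = refl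
  q₀≈1 {suc M} x = trans (+-identityʳ _) (trans (*-cong
    (trans (+-identityʳ _) (*-identityˡ 1#)) (q₀≈1 (x ∘ suc))) (*-identityˡ 1#))

-- Integer multiples of fractions

module ℚ-Multiples where

  open Algebra.Properties.Semiring.Mult
    (CommutativeRing.semiring ℚ.+-*-commutativeRing) using (_×_)

  /≡fromℚᵘ : ∀ i n .{{_ : NonZero n}} → i ℚ./ n ≡ ℚ.fromℚᵘ (i ℚᵘ./ n)
  /≡fromℚᵘ i (suc n) = ≡.refl

  fromℚᵘ-+ : ∀ p q → ℚ.fromℚᵘ p ℚ.+ ℚ.fromℚᵘ q ≡ ℚ.fromℚᵘ (p ℚᵘ.+ q)
  fromℚᵘ-+ p q = ℚ.toℚᵘ-injective (ℚᵘ.≃-trans (ℚ.toℚᵘ-homo-+ (ℚ.fromℚᵘ p) (ℚ.fromℚᵘ q))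
    (ℚᵘ.≃-trans (ℚᵘ.+-cong (ℚ.toℚᵘ-fromℚᵘ p) (ℚ.toℚᵘ-fromℚᵘ q))
                (ℚᵘ.≃-sym (ℚ.toℚᵘ-fromℚᵘ (p ℚᵘ.+ q)))))

  /-+ : ∀ i j d .{{_ : NonZero d}} → i ℚ./ d ℚ.+ j ℚ./ d ≡ (i ℤ.+ j) ℚ./ d
  /-+ i j d@(suc d-1) = ≡.trans (fromℚᵘ-+ (i ℚᵘ./ d) (j ℚᵘ./ d))
    (ℚ.fromℚᵘ-cong {i ℚᵘ./ d ℚᵘ.+ j ℚᵘ./ d} {(i ℤ.+ j) ℚᵘ./ d} (ℚᵘ.*≡* (solve 3
      (λ i j d → (i :* d :+ j :* d) :* d := (i :+ j) :* (d :* d)) ≡.refl i j (pos d))))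
    where open Data.Integer.Solver.+-*-Solver

  ×-/ : ∀ n i d .{{_ : NonZero d}} → n × (i ℚ./ d) ≡ (pos n ℤ.* i) ℚ./ d
  ×-/ zero    i d = ≡.trans (≡.sym (ℚ.0/n≡0 d)) (ℚ./-cong (≡.sym (ℤ.*-zeroˡ i)) ≡.refl)
  ×-/ (suc n) i d = ≡.trans (≡.cong (i ℚ./ d ℚ.+_) (×-/ n i d))
    (≡.trans (/-+ i (pos n ℤ.* i) d) (ℚ./-cong (≡.sym (ℤ.suc-* (pos n) i)) ≡.refl))

  ×-cancel-/ : ∀ n i d .{{_ : NonZero d}} .{{_ : NonZero (n ℕ.* d)}} →
               n × (i ℚ./ (n ℕ.* d)) ≡ i ℚ./ d
  ×-cancel-/ n i d = ≡.trans (×-/ n i (n ℕ.* d)) (≡.trans (/≡fromℚᵘ (pos n ℤ.* i) (n ℕ.* d))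
    (≡.trans (ℚ.fromℚᵘ-cong (ℚᵘ.*-cancelˡ-/ n)) (≡.sym (/≡fromℚᵘ i d))))

-- The exponential series over a ring containing ℚ

module SeriesExp {c ℓ} (R : CommutativeRing c ℓ) (ι : ℚ → CommutativeRing.Carrier R)
  (ι-hom : IsRingHomomorphism ℚ.+-*-rawRing (CommutativeRing.rawRing R) ι) where

  open CommutativeRing R hiding (zero)
  open SeriesRing R
  open SeriesCalculus R
  open PowerSeries.Exponential rawRing ι
  private
    module ι = IsRingHomomorphism ι-hom
    module S = CommutativeRing seriesRing
  open Algebra.Properties.Ring ring
    using (-‿distribˡ-*; -‿distribʳ-*; -‿involutive; -1*x≈-x)
  open Algebra.Properties.Semiring.Exp semiring using (_^_; ^-congˡ)
  open Algebra.Properties.Semiring.Mult semiring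
    using (_×_; ×-congʳ; ×-comm-*; ×-assoc-*)
  private
    module S× = Algebra.Properties.Semiring.Mult S.semiring
    module ℚ× = Algebra.Properties.Semiring.Mult
      (CommutativeRing.semiring ℚ.+-*-commutativeRing)
  open Algebra.Properties.CommutativeMonoid.Mult +-commutativeMonoid
    using (×-distrib-+)
  open Algebra.Properties.CommutativeMonoid.Sum +-commutativeMonoid
    using (sum; sum-cong-≋; sum-replicate-zero)
  open Algebra.Properties.Semiring.Sum semiring using (*-distribˡ-sum)
  open Algebra.Solver.Ring.NaturalCoefficients.Default commutativeSemiring
  open Relation.Binary.Reasoning.Setoid setoid
  open ℚ-Multiples

  ι-× : ∀ n a → n × ι a ≈ ι (n ℚ×.× a)
  ι-× zero    a = sym ι.0#-homo
  ι-× (suc n) a = trans (+-congˡ (ι-× n a)) (sym (ι.+-homo a (n ℚ×.× a)))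

  ι-×-/ : ∀ n i d .{{_ : NonZero d}} .{{_ : NonZero (n ℕ.* d)}} →
          n × ι (i ℚ./ (n ℕ.* d)) ≈ ι (i ℚ./ d)
  ι-×-/ n i d = trans (ι-× n _) (ι.⟦⟧-cong (×-cancel-/ n i d))

  ×-cancel : ∀ n {x y} → suc n × x ≈ suc n × y → x ≈ y
  ×-cancel n {x} {y} nx≈ny = trans (sym (divide x)) (trans (*-congˡ nx≈ny) (divide y))
    where
    -- With the denominator n · 1, the reduction n × 1/(n · 1) = 1/1 applies.
    1/n : ℚ
    1/n = pos 1 ℚ./ (suc n ℕ.* 1)
    divide : ∀ x → ι 1/n * (suc n × x) ≈ x
    divide x = begin
      ι 1/n * (suc n × x)  ≈⟨ ×-comm-* (suc n) (ι 1/n) x ⟩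
      suc n × (ι 1/n * x)  ≈⟨ ×-assoc-* (suc n) (ι 1/n) x ⟨
      (suc n × ι 1/n) * x  ≈⟨ *-congʳ (trans (ι-×-/ (suc n) (pos 1) 1) ι.1#-homo) ⟩
      1# * x               ≈⟨ *-identityˡ x ⟩
      x                    ∎

  ×-Σ≤ : ∀ n N f → n × Σ≤ N f ≈ Σ≤ N (λ k → n × f k)
  ×-Σ≤ n zero    f = trans (×-distrib-+ _ _ n) (+-congˡ (×0#≈0# n))
  ×-Σ≤ n (suc N) f = trans (×-distrib-+ _ _ n) (+-congˡ (×-Σ≤ n N (f ∘ suc)))

  *ₛ-Σ≤ : ∀ N g (a : ℕ → Carrier) (h : ℕ → Series) →
          g *ₛ (λ n → Σ≤ N λ k → a k * h k n) ≈ₛ λ n → Σ≤ N λ k → a k * (g *ₛ h k) n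
  *ₛ-Σ≤ N g a h n = trans (*ₛ-comm g (λ n → Σ≤ N λ k → a k * h k n) n) (trans (left N a h n)
    (Σ≤-cong N λ k _ → *-congˡ {a k} (*ₛ-comm (h k) g n)))
    where
    left : ∀ N (a : ℕ → Carrier) (h : ℕ → Series) →
           (λ n → Σ≤ N λ k → a k * h k n) *ₛ g ≈ₛ λ n → Σ≤ N λ k → a k * (h k *ₛ g) n
    left zero    a h n = trans (*ₛ-distribʳ g (λ n → a 0 * h 0 n) (λ _ → 0#) n)
      (+-cong (*ₛ-scaleˡ (a 0) (h 0) g n) (*ₛ-zeroˡ g n))
    left (suc N) a h n = trans
      (*ₛ-distribʳ g (λ n → a 0 * h 0 n) (λ n → Σ≤ N λ k → a (suc k) * h (suc k) n) n)
      (+-cong (*ₛ-scaleˡ (a 0) (h 0) g n) (left N (a ∘ suc) (h ∘ suc) n))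

  -- Natural multiples in the ring of power series are taken coefficientwise.
  ×ₛ≡× : ∀ n f k → (n S×.× f) k ≡ n × f k
  ×ₛ≡× zero    f k = ≡.refl
  ×ₛ≡× (suc n) f k = ≡.cong (λ y → f k + y) (×ₛ≡× n f k)

  θ-^ : ∀ f k → θ (f ^ₛ suc k) ≈ₛ λ n → suc k × (θ f *ₛ (f ^ₛ k)) n
  θ-^ f k n = trans (power k n) (reflexive (×ₛ≡× (suc k) (θ f *ₛ (f ^ₛ k)) n))
    where
    power : ∀ k → θ (f ^ₛ suc k) ≈ₛ suc k S×.× (θ f *ₛ (f ^ₛ k))
    power zero    = S.trans (θ-* f 1ₛ) (S.+-congˡ {θ f *ₛ 1ₛ}
      (S.trans (*ₛ-cong (S.refl {x = f}) θ-1) (S.zeroʳ f)))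
    power (suc k) = S.trans (θ-* f (f ^ₛ suc k)) (S.+-congˡ {θ f *ₛ (f ^ₛ suc k)}
      (S.trans (*ₛ-cong (S.refl {x = f}) (power k))
      (S.trans (S×.×-comm-* (suc k) f (θ f *ₛ (f ^ₛ k)))
        (S×.×-congʳ (suc k) (S.trans (S.sym (*ₛ-assoc f (θ f) (f ^ₛ k)))
          (S.trans (*ₛ-cong (*ₛ-comm f (θ f)) (S.refl {x = f ^ₛ k}))
                   (*ₛ-assoc (θ f) f (f ^ₛ k))))))))

  module _ (L : Series) (L₀≈0 : L 0 ≈ 0#) where

    ^ₛ-order : ∀ k n → n ℕ.< k → (L ^ₛ k) n ≈ 0#
    ^ₛ-order (suc k) zero    _         = trans (+-identityʳ _) (trans (*-congʳ L₀≈0) (zeroˡ _))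
    ^ₛ-order (suc k) (suc n) (s≤s n<k) = trans (+-cong (trans (*-congʳ L₀≈0) (zeroˡ _))
      (Σ≤-zero n λ j _ → trans (*-congˡ (^ₛ-order k (n ∸ j) (ℕ.≤-<-trans (ℕ.m∸n≤m n j) n<k)))
                               (zeroʳ (L (suc j))))) (+-identityʳ 0#)

    -- 1/k! in the ring.
    1/_! : ℕ → Carrier
    1/ k ! = ι ((pos 1 ℚ./ k !) {{k ℕ.!≢0}})

    ×-1/! : ∀ k → suc k × 1/ suc k ! ≈ 1/ k !
    ×-1/! k = ι-×-/ (suc k) (pos 1) (k !) {{k ℕ.!≢0}} {{suc k ℕ.!≢0}}

    -- The partial sums Σ Lᵏ/k!, k ≤ N, of the exponential series.
    partial : ℕ → Series
    partial N n = Σ≤ N λ k → 1/ k ! * (L ^ₛ k) n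

    partial≈exp : ∀ {n N} → n ℕ.≤ N → partial N n ≈ exp L n
    partial≈exp {n} n≤N = Σ≤-truncate (λ k → 1/ k ! * (L ^ₛ k) n) n≤N
      λ k n<k → trans (*-congˡ (^ₛ-order k n n<k)) (zeroʳ _)

    -- Differentiating a partial sum termwise lowers its length by one.
    θ-partial : ∀ N → θ (partial (suc N)) ≈ₛ θ L *ₛ partial N
    θ-partial N n = begin
      n × (1/ 0 ! * 1ₛ n + Σ≤ N λ k → 1/ suc k ! * (L ^ₛ suc k) n)
        ≈⟨ ×-distrib-+ _ _ n ⟩
      n × (1/ 0 ! * 1ₛ n) + n × Σ≤ N (λ k → 1/ suc k ! * (L ^ₛ suc k) n)
        ≈⟨ +-cong (trans (sym (×-comm-* n _ _)) (trans (*-congˡ (θ-1 n)) (zeroʳ _)))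
                  (×-Σ≤ n N λ k → 1/ suc k ! * (L ^ₛ suc k) n) ⟩
      0# + Σ≤ N (λ k → n × (1/ suc k ! * (L ^ₛ suc k) n))
        ≈⟨ +-identityˡ _ ⟩
      Σ≤ N (λ k → n × (1/ suc k ! * (L ^ₛ suc k) n))
        ≈⟨ Σ≤-cong N (λ k _ → term k) ⟩
      Σ≤ N (λ k → 1/ k ! * (θ L *ₛ (L ^ₛ k)) n)
        ≈⟨ *ₛ-Σ≤ N (θ L) 1/_! (L ^ₛ_) n ⟨
      (θ L *ₛ partial N) n ∎
      where
      term : ∀ k → n × (1/ suc k ! * (L ^ₛ suc k) n) ≈ 1/ k ! * (θ L *ₛ (L ^ₛ k)) n
      term k = begin
        n × (1/ suc k ! * (L ^ₛ suc k) n)                ≈⟨ ×-comm-* n _ _ ⟨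
        1/ suc k ! * θ (L ^ₛ suc k) n                    ≈⟨ *-congˡ (θ-^ L k n) ⟩
        1/ suc k ! * (suc k × (θ L *ₛ (L ^ₛ k)) n)       ≈⟨ ×-comm-* (suc k) _ _ ⟩
        suc k × (1/ suc k ! * (θ L *ₛ (L ^ₛ k)) n)       ≈⟨ ×-assoc-* (suc k) _ _ ⟨
        (suc k × 1/ suc k !) * (θ L *ₛ (L ^ₛ k)) n       ≈⟨ *-congʳ (×-1/! k) ⟩
        1/ k ! * (θ L *ₛ (L ^ₛ k)) n                     ∎

    -- At index n + 1 the product θL · exp L only involves exp L up to index n,
    -- because θL has no constant term; there exp L agrees with the n-th partial
    -- sum.
    LogDeriv-exp : LogDeriv (exp L) (θ L)
    LogDeriv-exp zero    = sym (trans (+-identityʳ _) (zeroˡ _))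
    LogDeriv-exp (suc n) = trans (θ-partial n (suc n))
      (+-cong (trans (zeroˡ _) (sym (zeroˡ _)))
        (Σ≤-cong n λ j _ → *-congˡ {θ L (suc j)} (partial≈exp (ℕ.m∸n≤m n j))))

    exp₀≈1 : exp L 0 ≈ 1#
    exp₀≈1 = trans (+-identityʳ _) (trans (*-identityʳ _) ι.1#-homo)

  -- (-1)ⁿ for n of the given parity.
  sign : Parity → Carrier
  sign 0ℙ = 1#
  sign 1ℙ = - 1#

  -‿^ : ∀ x n → (- x) ^ n ≈ sign (parity n) * x ^ n
  -‿^ x zero          = sym (*-identityˡ 1#)
  -‿^ x (suc zero)    = trans (*-identityʳ (- x))
    (sym (trans (-1*x≈-x _) (-‿cong (*-identityʳ x))))
  -‿^ x (suc (suc n)) = begin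
    - x * (- x * (- x) ^ n)                ≈⟨ *-assoc (- x) (- x) _ ⟨
    - x * - x * (- x) ^ n                  ≈⟨ *-cong (trans (sym (-‿distribˡ-* x (- x)))
         (trans (-‿cong (sym (-‿distribʳ-* x x))) (-‿involutive _))) (-‿^ x n) ⟩
    x * x * (sign (parity n) * x ^ n)      ≈⟨ solve 3 (λ x s p → x :* x :* (s :* p) := s :* (x :* (x :* p)))
                                                refl x (sign (parity n)) (x ^ n) ⟩
    sign (parity n) * (x * (x * x ^ n))    ∎

  -- The odd and the even coefficients of the logarithm, multiplied by their
  -- index.
  ×-[-2/n] : ∀ n x → suc n × (ι ((ℤ.- pos 2) ℚ./ suc n) * x) ≈ (- 1# - 1#) * x
  ×-[-2/n] n x = begin
    suc n × (ι ((ℤ.- pos 2) ℚ./ suc n) * x)           ≈⟨ ×-assoc-* (suc n) _ x ⟨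
    (suc n × ι ((ℤ.- pos 2) ℚ./ suc n)) * x           ≈⟨ *-congʳ (×-congʳ (suc n) (ι.⟦⟧-cong
                                                           (ℚ./-cong {ℤ.- pos 2} ≡.refl (≡.sym (ℕ.*-identityʳ (suc n)))))) ⟩
    (suc n × ι ((ℤ.- pos 2) ℚ./ (suc n ℕ.* 1))) * x   ≈⟨ *-congʳ (ι-×-/ (suc n) (ℤ.- pos 2) 1) ⟩
    ι (ℚ.- 1ℚ ℚ.+ ℚ.- 1ℚ) * x                         ≈⟨ *-congʳ (trans (ι.+-homo _ _) (+-cong ι-1 ι-1)) ⟩
    (- 1# - 1#) * x                                   ∎
    where
    ι-1 : ι (ℚ.- 1ℚ) ≈ - 1#
    ι-1 = trans (ι.-‿homo 1ℚ) (-‿cong ι.1#-homo)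

  ×-0#≈[1-1]* : ∀ n x → n × 0# ≈ (1# - 1#) * x
  ×-0#≈[1-1]* n x = trans (×0#≈0# n) (sym (trans (*-congʳ (-‿inverseʳ 1#)) (zeroˡ x)))

  -- The logarithm of Σ (-1)^m q_m(x) zᵐ is the series without constant term whose
  -- coefficient at zⁿ is ((-1)ⁿ - 1)/n times the n-th power sum of x.
  exp-q : ∀ {M} (x : Vector Carrier M) (L : Series) → L 0 ≈ 0# →
    (∀ n → suc n × L (suc n) ≈ (sign (parity (suc n)) - 1#) * sum (λ i → x i ^ suc n)) →
    exp L ≈ₛ scale (- 1#) (q x)
  exp-q {M} x L L₀≈0 θL = S.trans
    (LogDeriv-unique ×-cancel {exp L} {q y} {w} w₀≈0 exp-log (LogDeriv-q y)
      (trans (exp₀≈1 L L₀≈0) (sym (q₀≈1 y))))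
    (S.sym (q-scale (- 1#) x))
    where
    y : Vector Carrier M
    y i = - 1# * x i
    w : Series
    w n = sum λ i → - geom⁺ (- y i) n + geom⁺ (y i) n
    w₀≈0 : w 0 ≈ 0#
    w₀≈0 = trans (sum-cong-≋ {M} λ i → -‿inverseˡ 0#) (sum-replicate-zero M)
    y≈-x : ∀ i → y i ≈ - x i
    y≈-x i = -1*x≈-x (x i)
    w≈θL : w ≈ₛ θ L
    w≈θL zero    = w₀≈0
    w≈θL (suc n) = trans (sum-cong-≋ {M} term)
      (trans (sym (*-distribˡ-sum (s - 1#) λ i → x i ^ suc n)) (sym (θL n)))
      where
      s = sign (parity (suc n))
      term : ∀ i → - (- y i) ^ suc n + y i ^ suc n ≈ (s - 1#) * x i ^ suc n
      term i = begin
        - (- y i) ^ suc n + y i ^ suc n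
          ≈⟨ +-cong (-‿cong (^-congˡ (suc n) (trans (-‿cong (y≈-x i)) (-‿involutive _))))
                    (trans (^-congˡ (suc n) (y≈-x i)) (-‿^ (x i) (suc n))) ⟩
        - x i ^ suc n + s * x i ^ suc n
          ≈⟨ +-comm _ _ ⟩
        s * x i ^ suc n + - x i ^ suc n
          ≈⟨ +-congˡ (sym (-1*x≈-x _)) ⟩
        s * x i ^ suc n + - 1# * x i ^ suc n
          ≈⟨ distribʳ _ _ _ ⟨
        (s - 1#) * x i ^ suc n ∎
    exp-log : LogDeriv (exp L) w
    exp-log = S.trans (LogDeriv-exp L L₀≈0) (*ₛ-cong (S.sym w≈θL) (S.refl {x = exp L}))

-- Gaussian binomials and the q-binomial theorem

module Gaussian {c ℓ} (R : CommutativeRing c ℓ) where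

  open CommutativeRing R hiding (zero)
  open SeriesRing R
  open SeriesCalculus R
  private module S = CommutativeRing seriesRing
  open Algebra.Properties.Ring ring using (x[y-z]≈xy-xz)
  open Algebra.Properties.Semiring.Exp semiring
    using (_^_; ^-congʳ; ^-homo-*; ^-assocʳ)
  open Algebra.Properties.CommutativeMonoid.Sum +-commutativeMonoid
    using (sum; sum-cong-≋)
  open Algebra.Properties.CommutativeMonoid.Sum *-commutativeMonoid
    using () renaming (sum to product; ∑-distrib-+ to product-distrib-*)
  open Algebra.Properties.CommutativeMonoid.Sum S.*-commutativeMonoid
    using () renaming (∑-distrib-+ to productₛ-distrib-*ₛ)
  open Algebra.Properties.Semiring.Sum semiring using (*-distribˡ-sum)
  open Algebra.Solver.Ring.NaturalCoefficients.Default commutativeSemiring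
  open Relation.Binary.Reasoning.Setoid setoid

  product-last : ∀ k (f : ℕ → Carrier) →
                 product {suc k} (f ∘ toℕ) ≈ product {k} (f ∘ toℕ) * f k
  product-last zero    f = *-comm (f 0) 1#
  product-last (suc k) f = trans (*-congˡ (product-last k (f ∘ suc))) (sym (*-assoc _ _ _))

  [1-x]+x[1-y]≈1-xy : ∀ x y → (1# - x) + x * (1# - y) ≈ 1# - x * y
  [1-x]+x[1-y]≈1-xy x y = begin
    (1# - x) + x * (1# - y)        ≈⟨ +-congˡ (x[y-z]≈xy-xz x 1# y) ⟩
    (1# - x) + (x * 1# - x * y)    ≈⟨ solve 3 (λ x n m → (con 1 :+ n) :+ (x :* con 1 :+ m)
                                                      := (con 1 :+ m) :+ (n :+ x))
                                        refl x (- x) (- (x * y)) ⟩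
    (1# - x * y) + (- x + x)       ≈⟨ +-congˡ (-‿inverseˡ x) ⟩
    (1# - x * y) + 0#              ≈⟨ +-identityʳ _ ⟩
    1# - x * y                     ∎

  geometric-sum : ∀ u M → (1# - u) * sum {M} (λ i → u ^ toℕ i) ≈ 1# - u ^ M
  geometric-sum u zero    = trans (zeroʳ _) (sym (-‿inverseʳ 1#))
  geometric-sum u (suc M) = begin
    (1# - u) * (1# + sum {M} (λ i → u * u ^ toℕ i))
      ≈⟨ *-congˡ (+-congˡ (*-distribˡ-sum {M} u λ i → u ^ toℕ i)) ⟨
    (1# - u) * (1# + u * s)
      ≈⟨ solve 3 (λ v u s → v :* (con 1 :+ u :* s) := v :+ u :* (v :* s)) refl (1# - u) u s ⟩
    (1# - u) + u * ((1# - u) * s)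
      ≈⟨ +-congˡ (*-congˡ (geometric-sum u M)) ⟩
    (1# - u) + u * (1# - u ^ M)
      ≈⟨ [1-x]+x[1-y]≈1-xy u (u ^ M) ⟩
    1# - u ^ suc M ∎
    where s = sum {M} λ i → u ^ toℕ i

  1/1-xz-*-suc : ∀ x f n → ((1/1- x z) *ₛ f) (suc n) ≈ f (suc n) + x * ((1/1- x z) *ₛ f) n
  1/1-xz-*-suc x f n = +-cong (*-identityˡ _) (*ₛ-scaleˡ x (1/1- x z) f n)

  -- dₙ is an inverse of 1 - tⁿ⁺¹.
  module Binomials (t : Carrier) (d : ℕ → Carrier)
    (d-inverse : ∀ n → (1# - t ^ suc n) * d n ≈ 1#) where

    -- The Gaussian binomial ∏ (1 - tⁿ⁻ⁱ)/(1 - tⁱ⁺¹), i < k, with truncated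
    -- subtraction in the exponents.
    gaussian : ℕ → ℕ → Carrier
    gaussian n k = product {k} λ i → (1# - t ^ (n ∸ toℕ i)) * d (toℕ i)

    -- The numerator ∏ (1 - tⁿ⁻ⁱ), i < k, of a Gaussian binomial.
    numer : ℕ → ℕ → Carrier
    numer n k = product {k} λ i → 1# - t ^ (n ∸ toℕ i)

    -- The inverse of its denominator ∏ (1 - tⁱ⁺¹), i < k.
    denom⁻¹ : ℕ → Carrier
    denom⁻¹ k = product {k} (d ∘ toℕ)

    gaussian≈numer*denom⁻¹ : ∀ n k → gaussian n k ≈ numer n k * denom⁻¹ k
    gaussian≈numer*denom⁻¹ n k =
      product-distrib-* {k} (λ i → 1# - t ^ (n ∸ toℕ i)) (d ∘ toℕ)

    numer-zero : ∀ {n k} → n ℕ.< k → numer n k ≈ 0#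
    numer-zero {zero}  {suc k} _         = trans (*-congʳ (-‿inverseʳ 1#)) (zeroˡ _)
    numer-zero {suc n} {suc k} (s≤s n<k) = trans (*-congˡ (numer-zero n<k)) (zeroʳ _)

    gaussian-zero : ∀ {n k} → n ℕ.< k → gaussian n k ≈ 0#
    gaussian-zero {n} {k} n<k = trans (gaussian≈numer*denom⁻¹ n k)
      (trans (*-congʳ (numer-zero n<k)) (zeroˡ _))

    -- The identity 1 - tⁿ⁺¹ = (1 - tᵏ⁺¹) + tᵏ⁺¹ (1 - tⁿ⁻ᵏ) behind the Pascal rule.
    -- For k > n the truncated difference n ∸ k is not n - k, but then both
    -- sides vanish.
    numer-split : ∀ n k → numer n k * (1# - t ^ suc n) ≈
                  numer n k * ((1# - t ^ suc k) + t ^ suc k * (1# - t ^ (n ∸ k)))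
    numer-split n k with k ℕ.≤? n
    ... | yes k≤n = *-congˡ (begin
      1# - t ^ suc n                  ≈⟨ +-congˡ (-‿cong (^-congʳ t (ℕ.m+[n∸m]≡n (s≤s k≤n)))) ⟨
      1# - t ^ (suc k ℕ.+ (n ∸ k))    ≈⟨ +-congˡ (-‿cong (^-homo-* t (suc k) (n ∸ k))) ⟩
      1# - t ^ suc k * t ^ (n ∸ k)    ≈⟨ [1-x]+x[1-y]≈1-xy (t ^ suc k) (t ^ (n ∸ k)) ⟨
      (1# - t ^ suc k) + t ^ suc k * (1# - t ^ (n ∸ k)) ∎)
    ... | no k≰n = trans (vanish _) (sym (vanish _))
      where
      vanish : ∀ x → numer n k * x ≈ 0#
      vanish x = trans (*-congʳ (numer-zero (ℕ.≰⇒> k≰n))) (zeroˡ x)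

    pascal : ∀ n k → gaussian (suc n) (suc k) ≈
                     gaussian n k + t ^ suc k * gaussian n (suc k)
    pascal n k = begin
      gaussian (suc n) (suc k)
        ≈⟨ gaussian≈numer*denom⁻¹ (suc n) (suc k) ⟩
      ((1# - t ^ suc n) * N) * denom⁻¹ (suc k)
        ≈⟨ *-cong (*-comm _ _) (product-last k d) ⟩
      (N * (1# - t ^ suc n)) * (D * d k)
        ≈⟨ *-congʳ (numer-split n k) ⟩
      (N * ((1# - t ^ suc k) + t ^ suc k * w)) * (D * d k)
        ≈⟨ solve 6 (λ N D v p w d → (N :* (v :+ p :* w)) :* (D :* d)
                                 := (N :* D) :* (v :* d) :+ p :* ((N :* w) :* (D :* d)))
             refl N D (1# - t ^ suc k) (t ^ suc k) w (d k) ⟩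
      (N * D) * ((1# - t ^ suc k) * d k) + t ^ suc k * ((N * w) * (D * d k))
        ≈⟨ +-cong (trans (*-congˡ (d-inverse k)) (*-identityʳ _))
             (*-congˡ (*-cong (sym (product-last k λ i → 1# - t ^ (n ∸ i))) (sym (product-last k d)))) ⟩
      N * D + t ^ suc k * (numer n (suc k) * denom⁻¹ (suc k))
        ≈⟨ +-cong (gaussian≈numer*denom⁻¹ n k) (*-congˡ (gaussian≈numer*denom⁻¹ n (suc k))) ⟨
      gaussian n k + t ^ suc k * gaussian n (suc k) ∎
      where
      N = numer n k
      D = denom⁻¹ k
      w = 1# - t ^ (n ∸ k)

    -- The arguments 1, t, …, tᴹ⁻¹.
    powers : ∀ M → Vector Carrier M
    powers M i = t ^ toℕ i

    -- ∏ (1 + tⁱ z) and ∏ 1/(1 - tⁱ z) over i < M.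
    E : ℕ → Series
    E M = productₛ λ i → 1+ powers M i z

    H : ℕ → Series
    H M = productₛ λ i → 1/1- powers M i z

    E-suc : ∀ M → E (suc M) ≈ₛ (1+ 1# z) *ₛ scale t (E M)
    E-suc M = *ₛ-cong (S.refl {x = 1+ 1# z})
      (S.sym (scale-product t (λ i → 1+ powers M i z) _ λ i → scale-1+ t (powers M i)))

    H-suc : ∀ M → H (suc M) ≈ₛ (1/1- 1# z) *ₛ scale t (H M)
    H-suc M = *ₛ-cong (S.refl {x = 1/1- 1# z})
      (S.sym (scale-product t (λ i → 1/1- powers M i z) _ λ i → scale-1/1- t (powers M i)))

    E-coeff : ∀ M a → E M a ≈ t ^ (a C 2) * gaussian M a
    E-coeff zero    zero    = sym (*-identityˡ 1#)
    E-coeff zero    (suc a) = sym (trans (*-congˡ (gaussian-zero {0} {suc a} (s≤s z≤n))) (zeroʳ _))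
    E-coeff (suc M) zero    = trans (E-suc M 0) (trans (+-identityʳ _)
      (trans (*-identityˡ _) (trans (*-identityˡ _) (E-coeff M 0))))
    E-coeff (suc M) (suc a) = begin
      E (suc M) (suc a)
        ≈⟨ E-suc M (suc a) ⟩
      ((1+ 1# z) *ₛ scale t (E M)) (suc a)
        ≈⟨ 1+xz-*-suc 1# (scale t (E M)) a ⟩
      t ^ suc a * E M (suc a) + 1# * (t ^ a * E M a)
        ≈⟨ +-cong (*-congˡ (trans (E-coeff M (suc a)) (*-congʳ t^C)))
             (*-congˡ (*-congˡ (E-coeff M a))) ⟩
      t ^ suc a * (t ^ a * u * gaussian M (suc a)) + 1# * (t ^ a * (u * gaussian M a))
        ≈⟨ solve 5 (λ p q u g h → p :* (q :* u :* g) :+ con 1 :* (q :* (u :* h))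
                               := q :* u :* (h :+ p :* g))
             refl (t ^ suc a) (t ^ a) u (gaussian M (suc a)) (gaussian M a) ⟩
      t ^ a * u * (gaussian M a + t ^ suc a * gaussian M (suc a))
        ≈⟨ *-cong t^C (pascal M a) ⟨
      t ^ (suc a C 2) * gaussian (suc M) (suc a) ∎
      where
      u = t ^ (a C 2)
      -- C(a + 1, 2) = a + C(a, 2)
      t^C : t ^ (suc a C 2) ≈ t ^ a * u
      t^C = trans (^-congʳ t (≡.trans (≡.sym (nCk+nC[k+1]≡[n+1]C[k+1] a 1))
        (≡.cong (ℕ._+ a C 2) (nC1≡n a)))) (^-homo-* t a (a C 2))

    -- For M = 0 the upper index is b ∸ 1, which makes the binomial 1 for b = 0 and
    -- 0 for b > 0, as it should be for the empty product.
    H-coeff : ∀ M b → H M b ≈ gaussian (M ℕ.+ b ∸ 1) b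
    H-coeff zero    zero    = refl
    H-coeff zero    (suc b) = sym (gaussian-zero (ℕ.n<1+n b))
    H-coeff (suc M) zero    = trans (H-suc M 0) (trans (+-identityʳ _)
      (trans (*-identityˡ _) (trans (*-identityˡ _) (H-coeff M 0))))
    H-coeff (suc M) (suc b) = begin
      H (suc M) (suc b)
        ≈⟨ H-suc M (suc b) ⟩
      ((1/1- 1# z) *ₛ scale t (H M)) (suc b)
        ≈⟨ 1/1-xz-*-suc 1# (scale t (H M)) b ⟩
      t ^ suc b * H M (suc b) + 1# * ((1/1- 1# z) *ₛ scale t (H M)) b
        ≈⟨ +-cong (*-congˡ (H-coeff M (suc b))) (trans (*-identityˡ _)
             (trans (sym (H-suc M b)) (H-coeff (suc M) b))) ⟩
      t ^ suc b * gaussian (M ℕ.+ suc b ∸ 1) (suc b) + gaussian (M ℕ.+ b) b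
        ≈⟨ +-congʳ (*-congˡ (reflexive (≡.cong (λ n → gaussian (n ∸ 1) (suc b)) (ℕ.+-suc M b)))) ⟩
      t ^ suc b * gaussian (M ℕ.+ b) (suc b) + gaussian (M ℕ.+ b) b
        ≈⟨ +-comm _ _ ⟩
      gaussian (M ℕ.+ b) b + t ^ suc b * gaussian (M ℕ.+ b) (suc b)
        ≈⟨ pascal (M ℕ.+ b) b ⟨
      gaussian (suc (M ℕ.+ b)) (suc b)
        ≈⟨ reflexive (≡.cong (λ n → gaussian n (suc b)) (ℕ.+-suc M b)) ⟨
      gaussian (M ℕ.+ suc b) (suc b) ∎

    q-powers : ∀ M m → q (powers M) m ≈ Σ≤ (M ⊓ m) λ a →
      t ^ (a C 2) * gaussian M a * gaussian (M ℕ.+ m ∸ a ∸ 1) (m ∸ a)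
    q-powers M m = begin
      q (powers M) m
        ≈⟨ productₛ-distrib-*ₛ (λ i → 1+ powers M i z) (λ i → 1/1- powers M i z) m ⟩
      Σ≤ m (λ a → E M a * H M (m ∸ a))
        ≈⟨ truncate (ℕ.≤-total M m) ⟩
      Σ≤ (M ⊓ m) (λ a → E M a * H M (m ∸ a))
        ≈⟨ Σ≤-cong (M ⊓ m) (λ a a≤ → *-cong (E-coeff M a) (trans (H-coeff M (m ∸ a))
             (reflexive (≡.cong (λ n → gaussian (n ∸ 1) (m ∸ a))
               (≡.sym (ℕ.+-∸-assoc M (ℕ.≤-trans a≤ (ℕ.m⊓n≤n M m)))))))) ⟩
      Σ≤ (M ⊓ m) (λ a → t ^ (a C 2) * gaussian M a * gaussian (M ℕ.+ m ∸ a ∸ 1) (m ∸ a)) ∎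
      where
      g : ℕ → Carrier
      g a = E M a * H M (m ∸ a)
      -- For M < a ≤ m the term vanishes, because [M, a] does.
      truncate : _ → Σ≤ m g ≈ Σ≤ (M ⊓ m) g
      truncate (inj₁ M≤m) = trans
        (Σ≤-truncate g M≤m λ a M<a → trans (*-congʳ (trans (E-coeff M a)
          (trans (*-congˡ (gaussian-zero M<a)) (zeroʳ _)))) (zeroˡ _))
        (reflexive (≡.cong (λ n → Σ≤ n g) (≡.sym (ℕ.m≤n⇒m⊓n≡m M≤m))))
      truncate (inj₂ m≤M) = reflexive (≡.cong (λ n → Σ≤ n g) (≡.sym (ℕ.m≥n⇒m⊓n≡n m≤M)))

    power-sum : ∀ M n → (1# - (t ^ M) ^ suc n) * d n ≈ sum λ i → powers M i ^ suc n
    power-sum M n = begin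
      (1# - (t ^ M) ^ suc n) * d n
        ≈⟨ *-congʳ (+-congˡ (-‿cong (^-swap M))) ⟩
      (1# - u ^ M) * d n
        ≈⟨ *-congʳ (geometric-sum u M) ⟨
      (1# - u) * sum {M} (λ i → u ^ toℕ i) * d n
        ≈⟨ solve 3 (λ v s d → v :* s :* d := v :* d :* s) refl (1# - u) _ (d n) ⟩
      (1# - u) * d n * sum {M} (λ i → u ^ toℕ i)
        ≈⟨ trans (*-congʳ (d-inverse n)) (*-identityˡ _) ⟩
      sum {M} (λ i → u ^ toℕ i)
        ≈⟨ sum-cong-≋ {M} (λ i → ^-swap (toℕ i)) ⟨
      sum {M} (λ i → powers M i ^ suc n) ∎
      where
      u = t ^ suc n
      ^-swap : ∀ i → (t ^ i) ^ suc n ≈ u ^ i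
      ^-swap i = trans (^-assocʳ t i (suc n))
        (trans (^-congʳ t (ℕ.*-comm i (suc n))) (sym (^-assocʳ t (suc n) i)))

-- The one-row Q-functions are polynomials with coefficients in ℕ

module Closure {c ℓ} (R : CommutativeRing c ℓ) where

  open CommutativeRing R hiding (zero)
  open SeriesRing R
  open Algebra.Properties.Semiring.Exp semiring using (_^_)

  -- P holds for 0 and 1 and is closed under addition and multiplication.
  module Subsemiring {p} (P : Carrier → Set p) (P-0# : P 0#) (P-1# : P 1#)
    (P-+ : ∀ {x y} → P x → P y → P (x + y))
    (P-* : ∀ {x y} → P x → P y → P (x * y)) where

    P-^ : ∀ {x} → P x → ∀ n → P (x ^ n)
    P-^ Px zero    = P-1#
    P-^ Px (suc n) = P-* Px (P-^ Px n)

    P-*ₛ : ∀ {f g} → (∀ n → P (f n)) → (∀ n → P (g n)) → ∀ n → P ((f *ₛ g) n)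
    P-*ₛ Pf Pg zero    = P-+ (P-* (Pf 0) (Pg 0)) P-0#
    P-*ₛ Pf Pg (suc n) = P-+ (P-* (Pf 0) (Pg (suc n))) (P-*ₛ (Pf ∘ suc) Pg n)

    P-1+ : ∀ {x} → P x → ∀ n → P ((1+ x z) n)
    P-1+ Px zero          = P-1#
    P-1+ Px (suc zero)    = Px
    P-1+ Px (suc (suc _)) = P-0#

    P-q : ∀ {M} (x : Vector Carrier M) → (∀ i → P (x i)) → ∀ n → P (q x n)
    P-q {zero}  x Px zero    = P-1#
    P-q {zero}  x Px (suc n) = P-0#
    P-q {suc M} x Px n       = P-*ₛ
      (P-*ₛ {1+ x zero z} {1/1- x zero z} (P-1+ (Px zero)) (P-^ (Px zero)))
      (P-q (x ∘ suc) (Px ∘ suc)) n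

-- The commutative ring ℚ[t]

module Polynomials where

  open Defs.ℚ[t]
  open SeriesRing ℚ.+-*-commutativeRing using (_*ₛ_; 1ₛ; seriesRing; *ₛ-zeroˡ)

  coeff-* : ∀ p r i → coeff (p * r) i ≡ (coeff p *ₛ coeff r) i
  coeff-* []      r i       = ≡.sym (*ₛ-zeroˡ (coeff r) i)
  coeff-* (a ∷ p) r zero    = coeff-∷* a p r 0
  coeff-* (a ∷ p) r (suc i) =
    ≡.trans (coeff-∷* a p r (suc i)) (≡.cong (a ℚ.* coeff r (suc i) ℚ.+_) (coeff-* p r i))

  coeff-1 : ∀ i → coeff (const 1ℚ) i ≡ 1ₛ i
  coeff-1 zero    = ≡.refl
  coeff-1 (suc i) = ≡.refl

  -- The coefficients embed ℚ[t] into ℚ[[t]], from which it inherits the laws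
  -- of a commutative ring.
  coeff-isRingMonomorphism :
    IsRingMonomorphism rawRing (CommutativeRing.rawRing seriesRing) coeff
  coeff-isRingMonomorphism = record
    { isRingHomomorphism = record
      { isSemiringHomomorphism = record
        { isNearSemiringHomomorphism = record
          { +-isMonoidHomomorphism = record
            { isMagmaHomomorphism = record
              { isRelHomomorphism = record { cong = λ p≈r → p≈r }
              ; homo = coeff-+
              }
            ; ε-homo = λ _ → ≡.refl
            }
          ; *-homo = coeff-*
          }
        ; 1#-homo = coeff-1
        }
      ; -‿homo = coeff-neg
      }
    ; injective = λ p≈r → p≈r
    }

  polynomialRing : CommutativeRing 0ℓ 0ℓ
  polynomialRing = record
    { isCommutativeRing = Algebra.Morphism.RingMonomorphism.isCommutativeRing
        coeff-isRingMonomorphism (CommutativeRing.isCommutativeRing seriesRing)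
    }

  private module P = CommutativeRing polynomialRing
  open Algebra.Properties.Ring P.ring using ([y-z]x≈yx-zx)
  open Algebra.Properties.Group P.+-group using (x∙y⁻¹≈ε⇒x≈y; x≈y⇒x∙y⁻¹≈ε)

  -- (p - r) s = 0 forces each coefficient of p - r to be zero: a nonzero one
  -- would give a nonzero coefficient of the product.
  *-cancelʳ : ∀ {p r} s → NonZeroPoly s → p * s ≈ r * s → p ≈ r
  *-cancelʳ {p} {r} s s≢0 ps≈rs = x∙y⁻¹≈ε⇒x≈y p r λ i →
    decidable-stable (coeff (p + - r) i ℚ.≟ 0ℚ) λ p-r≢0 →
      let j , [p-r]s≢0 = *-nonZero (p + - r) s (i , p-r≢0) s≢0
      in  [p-r]s≢0 (≡.trans ([y-z]x≈yx-zx s p r j)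
            (x≈y⇒x∙y⁻¹≈ε {p * s} {r * s} ps≈rs j))

-- The field ℚ(t) as a commutative ring

-- The ring laws of fractions a/b, c/d, e/f, cross-multiplied.
module CrossMultiplication {c ℓ} (R : CommutativeRing c ℓ) where

  open CommutativeRing R hiding (zero)
  open Algebra.Solver.Ring.NaturalCoefficients.Default commutativeSemiring
  open Algebra.Properties.Ring ring using (-‿distribˡ-*)
  open Relation.Binary.Reasoning.Setoid setoid

  /-trans : ∀ a b c d e f → a * d ≈ c * b → c * f ≈ e * d → (a * f) * d ≈ (e * b) * d
  /-trans a b c d e f ad≈cb cf≈ed = begin
    (a * f) * d  ≈⟨ solve 3 (λ a f d → a :* f :* d := a :* d :* f) refl a f d ⟩
    (a * d) * f  ≈⟨ *-congʳ ad≈cb ⟩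
    (c * b) * f  ≈⟨ solve 3 (λ c b f → c :* b :* f := c :* f :* b) refl c b f ⟩
    (c * f) * b  ≈⟨ *-congʳ cf≈ed ⟩
    (e * d) * b  ≈⟨ solve 3 (λ e d b → e :* d :* b := e :* b :* d) refl e d b ⟩
    (e * b) * d  ∎

  /-+-cong : ∀ a b a′ b′ c d c′ d′ → a * b′ ≈ a′ * b → c * d′ ≈ c′ * d →
             (a * d + c * b) * (b′ * d′) ≈ (a′ * d′ + c′ * b′) * (b * d)
  /-+-cong a b a′ b′ c d c′ d′ ab′≈a′b cd′≈c′d = begin
    (a * d + c * b) * (b′ * d′)
      ≈⟨ solve 6 (λ a b c d b′ d′ → (a :* d :+ c :* b) :* (b′ :* d′)
                                 := a :* b′ :* (d :* d′) :+ c :* d′ :* (b :* b′))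
           refl a b c d b′ d′ ⟩
    a * b′ * (d * d′) + c * d′ * (b * b′)
      ≈⟨ +-cong (*-congʳ ab′≈a′b) (*-congʳ cd′≈c′d) ⟩
    a′ * b * (d * d′) + c′ * d * (b * b′)
      ≈⟨ solve 6 (λ a′ b c′ d b′ d′ → a′ :* b :* (d :* d′) :+ c′ :* d :* (b :* b′)
                                   := (a′ :* d′ :+ c′ :* b′) :* (b :* d))
           refl a′ b c′ d b′ d′ ⟩
    (a′ * d′ + c′ * b′) * (b * d) ∎

  /-*-cong : ∀ a b a′ b′ c d c′ d′ → a * b′ ≈ a′ * b → c * d′ ≈ c′ * d →
             (a * c) * (b′ * d′) ≈ (a′ * c′) * (b * d)
  /-*-cong a b a′ b′ c d c′ d′ ab′≈a′b cd′≈c′d = begin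
    (a * c) * (b′ * d′)  ≈⟨ interchange a c b′ d′ ⟩
    (a * b′) * (c * d′)  ≈⟨ *-cong ab′≈a′b cd′≈c′d ⟩
    (a′ * b) * (c′ * d)  ≈⟨ interchange a′ b c′ d ⟩
    (a′ * c′) * (b * d)  ∎
    where
    interchange : ∀ w x y z → (w * x) * (y * z) ≈ (w * y) * (x * z)
    interchange = solve 4 (λ w x y z → (w :* x) :* (y :* z) := (w :* y) :* (x :* z)) refl

  /--‿cong : ∀ a b c d → a * d ≈ c * b → - a * d ≈ - c * b
  /--‿cong a b c d ad≈cb =
    trans (sym (-‿distribˡ-* a d)) (trans (-‿cong ad≈cb) (-‿distribˡ-* c b))

  /-+-assoc : ∀ a b c d e f → ((a * d + c * b) * f + e * (b * d)) * (b * (d * f)) ≈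
                              (a * (d * f) + (c * f + e * d) * b) * ((b * d) * f)
  /-+-assoc = solve 6
    (λ a b c d e f → ((a :* d :+ c :* b) :* f :+ e :* (b :* d)) :* (b :* (d :* f))
                  := (a :* (d :* f) :+ (c :* f :+ e :* d) :* b) :* ((b :* d) :* f)) refl

  /-+-comm : ∀ a b c d → (a * d + c * b) * (d * b) ≈ (c * b + a * d) * (b * d)
  /-+-comm = solve 4
    (λ a b c d → (a :* d :+ c :* b) :* (d :* b) := (c :* b :+ a :* d) :* (b :* d)) refl

  /-+-identityˡ : ∀ a b → (0# * b + a * 1#) * b ≈ a * (1# * b)
  /-+-identityˡ = solve 2
    (λ a b → (con 0 :* b :+ a :* con 1) :* b := a :* (con 1 :* b)) refl

  /--‿inverseˡ : ∀ a b → (- a * b + a * b) * 1# ≈ 0# * (b * b)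
  /--‿inverseˡ a b = begin
    (- a * b + a * b) * 1#  ≈⟨ *-identityʳ _ ⟩
    - a * b + a * b         ≈⟨ distribʳ b (- a) a ⟨
    (- a + a) * b           ≈⟨ *-congʳ (-‿inverseˡ a) ⟩
    0# * b                  ≈⟨ trans (zeroˡ b) (sym (zeroˡ (b * b))) ⟩
    0# * (b * b)            ∎

  /-*-assoc : ∀ a b c d e f →
              ((a * c) * e) * (b * (d * f)) ≈ (a * (c * e)) * ((b * d) * f)
  /-*-assoc = solve 6
    (λ a b c d e f → ((a :* c) :* e) :* (b :* (d :* f)) := (a :* (c :* e)) :* ((b :* d) :* f)) refl

  /-*-comm : ∀ a b c d → (a * c) * (d * b) ≈ (c * a) * (b * d)
  /-*-comm = solve 4 (λ a b c d → (a :* c) :* (d :* b) := (c :* a) :* (b :* d)) refl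

  /-*-identityˡ : ∀ a b → (1# * a) * b ≈ a * (1# * b)
  /-*-identityˡ = solve 2 (λ a b → (con 1 :* a) :* b := a :* (con 1 :* b)) refl

  /-distribˡ : ∀ a b c d e f → (a * (c * f + e * d)) * ((b * d) * (b * f)) ≈
                               ((a * c) * (b * f) + (a * e) * (b * d)) * (b * (d * f))
  /-distribˡ = solve 6
    (λ a b c d e f → (a :* (c :* f :+ e :* d)) :* ((b :* d) :* (b :* f))
                  := ((a :* c) :* (b :* f) :+ (a :* e) :* (b :* d)) :* (b :* (d :* f))) refl

  -- The map a ↦ a/1 preserves + and *.
  /1-+ : ∀ a b → (a + b) * (1# * 1#) ≈ (a * 1# + b * 1#) * 1#
  /1-+ = solve 2 (λ a b → (a :+ b) :* (con 1 :* con 1) := (a :* con 1 :+ b :* con 1) :* con 1) refl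

  /1-* : ∀ a b → (a * b) * (1# * 1#) ≈ (a * b) * 1#
  /1-* = solve 2 (λ a b → (a :* b) :* (con 1 :* con 1) := (a :* b) :* con 1) refl

  -- a/1 · 1/a = 1/1
  a/1*1/a≈1/1 : ∀ a → (a * 1#) * 1# ≈ 1# * (1# * a)
  a/1*1/a≈1/1 = solve 1 (λ a → (a :* con 1) :* con 1 := con 1 :* (con 1 :* a)) refl

module RationalFunctions where

  open Defs
  open Polynomials using (polynomialRing; *-cancelʳ)
  private module P = CommutativeRing polynomialRing
  open CrossMultiplication polynomialRing

  functionField : CommutativeRing 0ℓ 0ℓ
  functionField = record
    { Carrier = ℚ⟨t⟩
    ; _≈_     = _≈_
    ; _+_     = _+_
    ; _*_     = _*_
    ; -_      = -_
    ; 0#      = 0#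
    ; 1#      = 1#
    ; isCommutativeRing = record
      { isRing = record
        { +-isAbelianGroup = record
          { isGroup = record
            { isMonoid = record
              { isSemigroup = record
                { isMagma = record
                  { isEquivalence = record
                    { refl  = λ {x} → ≈-refl x
                    ; sym   = λ {x} {y} → ≈-sym x y
                    ; trans = λ {x} {y} {z} → ≈-trans x y z
                    }
                  ; ∙-cong = λ {x} {x′} {y} {y′} → +-cong x x′ y y′
                  }
                ; assoc = +-assoc
                }
              ; identity = +-identityˡ , λ x →
                  ≈-trans (x + 0#) (0# + x) x (+-comm x 0#) (+-identityˡ x)
              }
            ; inverse = -‿inverseˡ , λ x →
                ≈-trans (x + - x) (- x + x) 0# (+-comm x (- x)) (-‿inverseˡ x)
            ; ⁻¹-cong = λ {x} {y} → -‿cong x y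
            }
          ; comm = +-comm
          }
        ; *-cong     = λ {x} {x′} {y} {y′} → *-cong x x′ y y′
        ; *-assoc    = *-assoc
        ; *-identity = *-identityˡ , λ x →
            ≈-trans (x * 1#) (1# * x) x (*-comm x 1#) (*-identityˡ x)
        ; distrib    = distribˡ , λ x y z →
            ≈-trans ((y + z) * x) (x * (y + z)) (y * x + z * x) (*-comm (y + z) x)
              (≈-trans (x * (y + z)) (x * y + x * z) (y * x + z * x) (distribˡ x y z)
                (+-cong (x * y) (y * x) (x * z) (z * x) (*-comm x y) (*-comm x z)))
        }
      ; *-comm = *-comm
      }
    }
    where
    ≈-refl : ∀ x → x ≈ x
    ≈-refl (fraction a b _) = P.refl {a ℚ[t].* b}

    ≈-sym : ∀ x y → x ≈ y → y ≈ x
    ≈-sym (fraction a b _) (fraction c d _) = P.sym {a ℚ[t].* d} {c ℚ[t].* b}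

    ≈-trans : ∀ x y z → x ≈ y → y ≈ z → x ≈ z
    ≈-trans (fraction a b _) (fraction c d d≢0) (fraction e f _) x≈y y≈z =
      *-cancelʳ {a ℚ[t].* f} {e ℚ[t].* b} d d≢0 (/-trans a b c d e f x≈y y≈z)

    +-cong : ∀ x x′ y y′ → x ≈ x′ → y ≈ y′ → x + y ≈ x′ + y′
    +-cong (fraction a b _) (fraction a′ b′ _) (fraction c d _) (fraction c′ d′ _) =
      /-+-cong a b a′ b′ c d c′ d′

    *-cong : ∀ x x′ y y′ → x ≈ x′ → y ≈ y′ → x * y ≈ x′ * y′
    *-cong (fraction a b _) (fraction a′ b′ _) (fraction c d _) (fraction c′ d′ _) =
      /-*-cong a b a′ b′ c d c′ d′

    -‿cong : ∀ x y → x ≈ y → - x ≈ - y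
    -‿cong (fraction a b _) (fraction c d _) = /--‿cong a b c d

    +-assoc : ∀ x y z → (x + y) + z ≈ x + (y + z)
    +-assoc (fraction a b _) (fraction c d _) (fraction e f _) = /-+-assoc a b c d e f

    +-comm : ∀ x y → x + y ≈ y + x
    +-comm (fraction a b _) (fraction c d _) = /-+-comm a b c d

    +-identityˡ : ∀ x → 0# + x ≈ x
    +-identityˡ (fraction a b _) = /-+-identityˡ a b

    -‿inverseˡ : ∀ x → - x + x ≈ 0#
    -‿inverseˡ (fraction a b _) = /--‿inverseˡ a b

    *-assoc : ∀ x y z → (x * y) * z ≈ x * (y * z)
    *-assoc (fraction a b _) (fraction c d _) (fraction e f _) = /-*-assoc a b c d e f

    *-comm : ∀ x y → x * y ≈ y * x
    *-comm (fraction a b _) (fraction c d _) = /-*-comm a b c d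

    *-identityˡ : ∀ x → 1# * x ≈ x
    *-identityˡ (fraction a b _) = /-*-identityˡ a b

    distribˡ : ∀ x y z → x * (y + z) ≈ x * y + x * z
    distribˡ (fraction a b _) (fraction c d _) (fraction e f _) = /-distribˡ a b c d e f

  -- Equality in ℚ(t) unfolds to equations between coefficients, from which the
  -- fractions cannot be inferred; they are therefore given explicitly.
  private module K = CommutativeRing functionField

  fromPoly-cong : ∀ {p r} → p ℚ[t].≈ r → fromPoly p ≈ fromPoly r
  fromPoly-cong {p} {r} p≈r = P.*-congʳ {ℚ[t].const 1ℚ} {p} {r} p≈r

  fromPoly-+ : ∀ p r → fromPoly (p ℚ[t].+ r) ≈ fromPoly p + fromPoly r
  fromPoly-+ = /1-+

  fromPoly-* : ∀ p r → fromPoly (p ℚ[t].* r) ≈ fromPoly p * fromPoly r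
  fromPoly-* = /1-*

  fromPoly-^ : ∀ p n → fromPoly (p ℚ[t].^ n) ≈ fromPoly p ^ n
  fromPoly-^ p zero    = K.refl {1#}
  fromPoly-^ p (suc n) = K.trans {fromPoly (p ℚ[t].* p ℚ[t].^ n)}
    {fromPoly p * fromPoly (p ℚ[t].^ n)} {fromPoly p * fromPoly p ^ n}
    (fromPoly-* p (p ℚ[t].^ n))
    (K.*-congˡ {fromPoly p} {fromPoly (p ℚ[t].^ n)} {fromPoly p ^ n} (fromPoly-^ p n))

  fromℚ-isRingHomomorphism : IsRingHomomorphism ℚ.+-*-rawRing K.rawRing fromℚ
  fromℚ-isRingHomomorphism = record
    { isSemiringHomomorphism = record
      { isNearSemiringHomomorphism = record
        { +-isMonoidHomomorphism = record
          { isMagmaHomomorphism = record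
            { isRelHomomorphism = record { cong = λ { {a} ≡.refl → K.refl {fromℚ a} } }
            ; homo = λ a b → fromPoly-+ (ℚ[t].const a) (ℚ[t].const b)
            }
          ; ε-homo = fromPoly-cong {ℚ[t].const 0ℚ} {[]} λ { zero → ≡.refl ; (suc i) → ≡.refl }
          }
        ; *-homo = λ a b → K.trans {fromℚ (a ℚ.* b)}
            {fromPoly (ℚ[t].const a ℚ[t].* ℚ[t].const b)} {fromℚ a * fromℚ b}
            (fromPoly-cong {ℚ[t].const (a ℚ.* b)} {ℚ[t].const a ℚ[t].* ℚ[t].const b}
              λ { zero → ≡.sym (ℚ.+-identityʳ _) ; (suc i) → ≡.refl })
            (fromPoly-* (ℚ[t].const a) (ℚ[t].const b))
        }
      ; 1#-homo = K.refl {1#}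
      }
    ; -‿homo = λ a → K.refl { - fromℚ a}
    }

  1-t^n-inverse : ∀ n → (1# - t ^ suc n) * 1/[1-t^ suc n ] ≈ 1#
  1-t^n-inverse n = begin
    (1# - t ^ suc n) * 1/[1-t^ suc n ]
      ≈⟨ K.*-congʳ {1/[1-t^ suc n ]} {1# - t ^ suc n} {1# - fromPoly tⁿ}
           (K.+-congˡ {1#} { - (t ^ suc n)} { - fromPoly tⁿ}
             (K.-‿cong {t ^ suc n} {fromPoly tⁿ}
               (K.sym {fromPoly tⁿ} {t ^ suc n} (fromPoly-^ ℚ[t].t (suc n))))) ⟩
    (1# - fromPoly tⁿ) * 1/[1-t^ suc n ]
      ≈⟨ K.*-congʳ {1/[1-t^ suc n ]} {fromPoly 1-tⁿ} {1# - fromPoly tⁿ}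
           (fromPoly-+ (ℚ[t].const 1ℚ) (ℚ[t].- tⁿ)) ⟨
    fromPoly 1-tⁿ * 1/[1-t^ suc n ]
      ≈⟨ a/1*1/a≈1/1 1-tⁿ ⟩
    1# ∎
    where
    open Relation.Binary.Reasoning.Setoid K.setoid
    tⁿ 1-tⁿ : ℚ[t].Poly
    tⁿ   = ℚ[t].t ℚ[t].^ suc n
    1-tⁿ = ℚ[t].const 1ℚ ℚ[t].+ ℚ[t].- tⁿ

-- The exponent in the definition of F

module LogarithmOfF where

  open Defs
  open RationalFunctions
  private module K = CommutativeRing functionField
  open Gaussian.Binomials functionField t (λ n → 1/[1-t^ suc n ]) 1-t^n-inverse
    using (powers; power-sum)
  open SeriesExp functionField fromℚ fromℚ-isRingHomomorphism
    using (sign; ×-[-2/n]; ×-0#≈[1-1]*)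
  open Algebra.Properties.Semiring.Mult K.semiring using (_×_)
  open Algebra.Properties.CommutativeMonoid.Sum K.+-commutativeMonoid using (sum)

  logF-coeff : ∀ M n → suc n × logF (t ^ M) (suc n) ≈
               (sign (parity (suc n)) - 1#) * sum (λ i → powers M i ^ suc n)
  logF-coeff M n with parity (suc n)
  ... | 0ℙ = ×-0#≈[1-1]* (suc n) (sum λ i → powers M i ^ suc n)
  ... | 1ℙ = K.trans
    {suc n × (fromℚ ((ℤ.- pos 2) ℚ./ suc n) * x)} {(- 1# - 1#) * x}
    {(- 1# - 1#) * sum (λ i → powers M i ^ suc n)}
    (×-[-2/n] n x)
    (K.*-congˡ { - 1# - 1#} {x} {sum λ i → powers M i ^ suc n} (power-sum M n))
    where
    x : ℚ⟨t⟩
    x = (1# - (t ^ M) ^ suc n) * 1/[1-t^ suc n ]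

open import Data.Product.Base using (_×_; ∃)

-- Rational functions that are polynomials with coefficients in ℕ

module NaturalCoefficients where

  open Defs
  open RationalFunctions
  private module K = CommutativeRing functionField
  open Algebra.Properties.Semiring.Mult (CommutativeRing.semiring ℚ.+-*-commutativeRing)
    using () renaming (_×_ to _×ℚ_; ×-homo-+ to ×ℚ-homo-+; ×1-homo-* to ×ℚ1-homo-*)

  -- Membership in ℕ, as the multiples of 1: in this form the closure under + and *
  -- are general facts about semirings.
  IsNatural : ℚ → Set
  IsNatural a = ∃ λ n → a ≡ n ×ℚ 1ℚ

  0-natural : IsNatural 0ℚ
  0-natural = 0 , ≡.refl

  +-natural : ∀ {a b} → IsNatural a → IsNatural b → IsNatural (a ℚ.+ b)
  +-natural (m , ≡.refl) (n , ≡.refl) = m ℕ.+ n , ≡.sym (×ℚ-homo-+ 1ℚ m n)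

  *-natural : ∀ {a b} → IsNatural a → IsNatural b → IsNatural (a ℚ.* b)
  *-natural (m , ≡.refl) (n , ≡.refl) = m ℕ.* n , ≡.sym (×ℚ1-homo-* m n)

  All-+ : ∀ {p r} → All IsNatural p → All IsNatural r → All IsNatural (p ℚ[t].+ r)
  All-+ []       r        = r
  All-+ (a ∷ p)  []       = a ∷ p
  All-+ (a ∷ p)  (b ∷ r)  = +-natural a b ∷ All-+ p r

  All-· : ∀ {a p} → IsNatural a → All IsNatural p → All IsNatural (a ℚ[t].· p)
  All-· a []      = []
  All-· a (b ∷ p) = *-natural a b ∷ All-· a p

  All-* : ∀ {p r} → All IsNatural p → All IsNatural r → All IsNatural (p ℚ[t].* r)
  All-* []      r = []
  All-* (a ∷ p) r = All-+ (All-· a r) (0-natural ∷ All-* p r)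

  toℕ[t] : ∀ {p} → All IsNatural p → ∃ λ (P : ℕ[t]) → p ≡ map (λ n → pos n ℚ./ 1) P
  toℕ[t] []              = [] , ≡.refl
  toℕ[t] ((n , a≡n) ∷ p) =
    let P , p≡P = toℕ[t] p
    in  n ∷ P , ≡.cong₂ _∷_ (≡.trans a≡n (≡.trans (ℚ-Multiples.×-/ n (pos 1) 1)
          (ℚ./-cong (ℤ.*-identityʳ (pos n)) ≡.refl))) p≡P

  -- The image of ℕ[t] in ℚ(t).
  InℕImage : ℚ⟨t⟩ → Set
  InℕImage x = ∃ λ p → All IsNatural p × x ≈ fromPoly p

  InℕImage⇒fromℕ[t] : ∀ {x} → InℕImage x → ∃ λ (P : ℕ[t]) → x ≈ fromℕ[t] P
  InℕImage⇒fromℕ[t] (p , p-natural , x≈p) with toℕ[t] p-natural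
  ... | P , ≡.refl = P , x≈p

  0#-natural : InℕImage 0#
  0#-natural = [] , [] , K.refl {0#}

  1#-natural : InℕImage 1#
  1#-natural = ℚ[t].const 1ℚ , (1 , ≡.refl) ∷ [] , K.refl {1#}

  t-natural : InℕImage t
  t-natural = ℚ[t].t , 0-natural ∷ (1 , ≡.refl) ∷ [] , K.refl {t}

  +-closed : ∀ {x y} → InℕImage x → InℕImage y → InℕImage (x + y)
  +-closed {x} {y} (p , p-nat , x≈p) (r , r-nat , y≈r) = p ℚ[t].+ r , All-+ p-nat r-nat ,
    K.trans {x + y} {fromPoly p + fromPoly r} {fromPoly (p ℚ[t].+ r)}
      (K.+-cong {x} {fromPoly p} {y} {fromPoly r} x≈p y≈r)
      (K.sym {fromPoly (p ℚ[t].+ r)} {fromPoly p + fromPoly r} (fromPoly-+ p r))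

  *-closed : ∀ {x y} → InℕImage x → InℕImage y → InℕImage (x * y)
  *-closed {x} {y} (p , p-nat , x≈p) (r , r-nat , y≈r) = p ℚ[t].* r , All-* p-nat r-nat ,
    K.trans {x * y} {fromPoly p * fromPoly r} {fromPoly (p ℚ[t].* r)}
      (K.*-cong {x} {fromPoly p} {y} {fromPoly r} x≈p y≈r)
      (K.sym {fromPoly (p ℚ[t].* r)} {fromPoly p * fromPoly r} (fromPoly-* p r))

  open Closure.Subsemiring functionField InℕImage 0#-natural 1#-natural
    (λ {x} {y} → +-closed {x} {y}) (λ {x} {y} → *-closed {x} {y}) public

open import Defs

proposition4p2 : ∀ (M : ℕ) → 1 ℕ.≤ M → ∀ (m : ℕ) →
    (f M m ≈ (- 1#) ^ m * q {M} (λ i → t ^ toℕ i) m) ×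
    (∃ λ (P : ℕ[t]) → (- 1#) ^ m * f M m ≈ fromℕ[t] P) ×
    ((- 1#) ^ m * f M m ≈ Σ≤ (M ⊓ m) (λ a → t ^ (a C 2) * gaussian M a * gaussian (M ℕ.+ m ∸ a ∸ 1) (m ∸ a)))
proposition4p2 M _ m = f≈ , InℕImage⇒fromℕ[t] {(- 1#) ^ m * f M m} natural , formula
  where
  open RationalFunctions
  open NaturalCoefficients
  module K = CommutativeRing functionField
  open Gaussian.Binomials functionField t (λ n → 1/[1-t^ suc n ]) 1-t^n-inverse
    using (powers; q-powers)
  open SeriesExp functionField fromℚ fromℚ-isRingHomomorphism using (exp-q)
  open SeriesCalculus functionField using (scale-involutive)

  x : Vector ℚ⟨t⟩ M
  x = powers M

  f≈ : f M m ≈ (- 1#) ^ m * q x m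
  f≈ = exp-q x (logF (t ^ M)) (K.refl {0#}) (LogarithmOfF.logF-coeff M) m

  -- Both fractions are closed terms, so their coefficients can be computed.
  [-1]²≈1 : (- 1#) * (- 1#) ≈ 1#
  [-1]²≈1 zero    = ≡.refl
  [-1]²≈1 (suc i) = ≡.refl

  [-1]^m-cancel : (- 1#) ^ m * f M m ≈ q x m
  [-1]^m-cancel = K.trans {(- 1#) ^ m * f M m} {(- 1#) ^ m * ((- 1#) ^ m * q x m)} {q x m}
    (K.*-congˡ {(- 1#) ^ m} {f M m} {(- 1#) ^ m * q x m} f≈)
    (scale-involutive (- 1#) (q x) [-1]²≈1 m)

  natural : InℕImage ((- 1#) ^ m * f M m)
  natural = let p , p-natural , q≈p = P-q x (P-^ t-natural ∘ toℕ) m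
            in  p , p-natural , K.trans {(- 1#) ^ m * f M m} {q x m} {fromPoly p} [-1]^m-cancel q≈p

  formula : (- 1#) ^ m * f M m ≈ Σ≤ (M ⊓ m) (λ a →
              t ^ (a C 2) * gaussian M a * gaussian (M ℕ.+ m ∸ a ∸ 1) (m ∸ a))
  formula = K.trans {(- 1#) ^ m * f M m} {q x m} {Σ≤ (M ⊓ m) (λ a →
              t ^ (a C 2) * gaussian M a * gaussian (M ℕ.+ m ∸ a ∸ 1) (m ∸ a))}
              [-1]^m-cancel (q-powers M m)
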